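{- For every integer $n\ge 1$, the second factorial moment of the area statistic on parking functions of length $n$ is $$\mathbb{E}\big[\mathrm{Area}(\mathrm{Area}-1)\big] \;=\; -\frac{7}{3}(n+1)\,E_1(n)+\frac{5}{12}n^{3}-\frac{1}{12}n^{2}-\frac{1}{3}n ,$$ and asymptotically it equals $\frac{5}{12}n^{3}+O(n^{5/2})$ as $n\to\infty$.
   Context: A parking function of length $n$ is a vector $(p_1,\dots,p_n)$ of positive integers such that its weakly increasing rearrangement $p_{(1)}\le p_{(2)}\le\dots\le p_{(n)}$ satisfies $p_{(i)}\le i$ for all $1\le i\le n$. There are $(n+1)^{n-1}$ of them. The area statistic is $\mathrm{Area}(p)=\frac{n(n+1)}{2}-\sum_{i=1}^n p_i$. Expectations are taken with respect to the uniform distribution on the set of parking functions of length $n$; the $k$-th factorial moment is $\mathbb{E}[\mathrm{Area}(\mathrm{Area}-1)\cdots(\mathrm{Area}-k+1)]$. Here $E_1(n)$ denotes $$E_1(n)= -\frac{n}{2}+\frac{1}{2}\,\frac{(n+1)!}{(n+1)^{n}}\sum_{k=0}^{n-1}\frac{(n+1)^k}{k!},$$ which is the expectation of the area statistic on parking functions of length $n$. -}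

module Defs where

open import Data.Nat as ℕ using (ℕ; zero; suc)
open import Data.Nat.Properties using (≤-decTotalOrder; _≤?_)
open import Data.Nat using (_!)
open import Data.Integer as ℤ using (ℤ; +_)
open import Data.Rational as ℚ using (ℚ; _/_)
open import Data.List using (List; []; _∷_; length; filter; map; concatMap; applyUpTo; zip; foldr)
open import Data.List.Relation.Unary.All using (All; all?)
open import Data.Product using (_×_; _,_; uncurry)
open import Data.Sum using ()
open import Relation.Nullary using (Dec)
open import Data.List.Sort.InsertionSort.Base ≤-decTotalOrder using (sort)

sorted : List ℕ → List ℕ
sorted = sort

IsParking : List ℕ → Set
IsParking p =
  All (λ x → 1 ℕ.≤ x) p ×
  All (λ xi → Data.Product.proj₁ xi ℕ.≤ Data.Product.proj₂ xi)
      (zip (sorted p) (applyUpTo suc (length p)))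

isParking? : (p : List ℕ) → Dec (IsParking p)
isParking? p = Relation.Nullary.Decidable._×-dec_
  (all? (λ x → 1 ≤? x) p)
  (all? (λ xi → Data.Product.proj₁ xi ≤? Data.Product.proj₂ xi)
        (zip (sorted p) (applyUpTo suc (length p))))
  where import Relation.Nullary.Decidable

words : ℕ → ℕ → List (List ℕ)
words m zero = [] ∷ []
words m (suc k) = concatMap (λ w → map (λ x → x ∷ w) (applyUpTo suc m)) (words m k)

-- the list of all parking functions of length n (each parking function has
-- entries in {1,...,n}, so filtering {1..n}^n gives exactly all of them)
parkingFunctions : ℕ → List (List ℕ)
parkingFunctions n = filter isParking? (words n n)

sumℕ : List ℕ → ℕ
sumℕ = foldr ℕ._+_ 0

area : ℕ → List ℕ → ℤ
area n p = (+ ((n ℕ.* suc n) ℕ./ 2)) ℤ.- (+ sumℕ p)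

-- mean of a finite list of integers (the uniform expectation);
-- the empty list is given mean 0 (never used for n ≥ 1)
mean : List ℤ → ℚ
mean [] = ℚ.0ℚ
mean (x ∷ xs) = (foldr ℤ._+_ (+ 0) (x ∷ xs)) / suc (length xs)

secondFactorialMoment : ℕ → ℚ
secondFactorialMoment n =
  mean (map (λ p → area n p ℤ.* (area n p ℤ.- ℤ.1ℤ)) (parkingFunctions n))

ℕtoℚ : ℕ → ℚ
ℕtoℚ k = (+ k) / 1

powℚ : ℚ → ℕ → ℚ
powℚ q zero = ℚ.1ℚ
powℚ q (suc k) = q ℚ.* powℚ q k

sumTo : ℕ → (ℕ → ℚ) → ℚ
sumTo zero f = ℚ.0ℚ
sumTo (suc m) f = sumTo m f ℚ.+ f m

E₁ : ℕ → ℚ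
E₁ n = ℚ.- ((+ n) / 2) ℚ.+
  (((+ 1) / 2) ℚ.* ((+ ((suc n) !)) / (suc n ℕ.^ n)) {{ m^n≢0 (suc n) n }}) ℚ.*
  sumTo n (λ k → ((+ (suc n ℕ.^ k)) / (k !)) {{ k !≢0 }})
  where
  open import Data.Nat.Properties using (m^n≢0; _!≢0)

{-# OPTIONS --safe #-}
-- Call a word w of length n over {1,…,m} parked when its sorted entries satisfy w₍ᵢ₎ ≤ m + 1 − n + (i − 1);
-- for m = n these are the parking functions. Deleting the ones of w and decreasing the other entries
-- preserves parkedness for alphabets m + 1 and m, and drops the sum t of all (wᵢ − 1) by the length of
-- the result. Hence, with N = m + 1, the exponential generating functions in n of the sums of 1, t and t²
-- satisfy G_{N+1} = e^x (G_N + …), where the dots involve x d/dx of the lower moments, with the boundary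
-- condition that the coefficient of index n = N vanishes (no nonempty word is parked when m + 1 − n = 0).
-- The solutions are e^{Nx} times Laurent polynomials in 1 − x with coefficients polynomial in N. At
-- n = N − 1 the coefficients of all e^{Nx} (1 − x)^k reduce linearly to those for k = 1, which is N^{n−1},
-- and k = −1, which is q = Σ_{i ≤ n} (n!/i!) Nⁱ, the sum occurring in E₁(n).
-- For the asymptotics, q² ≤ 2 N^{2n+1} follows by induction on n.
module Submission where

open import Defs
open import Data.Nat as ℕ using (ℕ; zero; suc; _≥_; z≤n; s≤s; _!)
open import Data.Integer as ℤ using (ℤ; +_; -[1+_]; 0ℤ; 1ℤ)
open import Data.Bool using (Bool; true; false; if_then_else_; _∧_)
open import Data.List using (List; []; _∷_; _++_; length; map; foldr; filter; zip; concatMap; replicate; applyUpTo)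
open import Data.List.Relation.Unary.All as All using (All; []; _∷_; all?)
import Data.Nat.Properties as ℕₚ
open import Data.List.Sort.InsertionSort.Base ℕₚ.≤-decTotalOrder using (insert; sort)
open import Data.Maybe using (just; nothing)
open import Data.Product using (_×_; ∃-syntax; _,_; proj₁; proj₂)
open import Data.Sum using (inj₁; inj₂)
open import Function using (_∘_)
open import Level using (0ℓ)
open import Relation.Binary.PropositionalEquality
open import Relation.Nullary using (does; yes; no)
open import Relation.Nullary.Decidable using (dec-true)
open import Relation.Unary using (Decidable)
import Data.Integer.Properties as ℤₚ
import Data.List.Properties as Listₚ
import Data.List.Relation.Unary.All.Properties as Allₚ
import Data.Nat.DivMod as ℕ/
import Data.Integer.Tactic.RingSolver as ℤ-Ring
import Data.Nat.Tactic.RingSolver as ℕ-Ring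

module IntegerMoments where
  open import Data.Integer using (_+_; _*_; -_; _-_)
  open import Data.Integer.Tactic.RingSolver using (solve-∀)
  open ≡-Reasoning

  -- Coefficients of e^{Nx} (1 - x)^k.

  -- n! [xⁿ] e^{Nx} (1 − x)^k, by the recursion read off from d/dx.
  coeff : ℤ → ℤ → ℕ → ℤ
  coeff N k zero = 1ℤ
  coeff N k (suc n) = N * coeff N k n - k * coeff N (ℤ.pred k) n

  -- Apply x d/dx to e^{Nx} (1 - x)^k and write each factor x as 1 - (1 - x). The same rewriting of
  -- multiplication by x gives `coeff-suc`. The two are proved together: `coeff-suc` at n uses
  -- `coeff-mul` at n, and `coeff-mul` at n + 1 uses `coeff-suc` at n.
  coeff-mul : ∀ N k n → + n * coeff N k n ≡
    N * (coeff N k n - coeff N (ℤ.suc k) n) - k * (coeff N (ℤ.pred k) n - coeff N k n)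
  coeff-suc : ∀ N k n → + suc n * coeff N k n ≡ coeff N k (suc n) - coeff N (ℤ.suc k) (suc n)

  coeff-suc N k n = begin
    + suc n * coeff N k n ≡⟨ lem₁ (+ n) (coeff N k n) ⟩
    + n * coeff N k n + coeff N k n ≡⟨ cong (_+ coeff N k n) (coeff-mul N k n) ⟩
    N * (coeff N k n - coeff N (ℤ.suc k) n) - k * (coeff N (ℤ.pred k) n - coeff N k n) + coeff N k n
      ≡⟨ lem₂ N k (coeff N k n) (coeff N (ℤ.suc k) n) (coeff N (ℤ.pred k) n) ⟩
    (N * coeff N k n - k * coeff N (ℤ.pred k) n) - (N * coeff N (ℤ.suc k) n - ℤ.suc k * coeff N k n)
      ≡⟨ cong (λ i → coeff N k (suc n) - (N * coeff N (ℤ.suc k) n - ℤ.suc k * coeff N i n)) (ℤₚ.pred-suc k) ⟨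
    coeff N k (suc n) - coeff N (ℤ.suc k) (suc n) ∎
    where
    lem₁ : ∀ n x → (1ℤ + n) * x ≡ n * x + x
    lem₁ = solve-∀
    lem₂ : ∀ N k x y z → N * (x - y) - k * (z - x) + x ≡ (N * x - k * z) - (N * y - (1ℤ + k) * x)
    lem₂ = solve-∀

  coeff-mul N k zero = lem N k
    where
    lem : ∀ N k → 0ℤ ≡ N * (1ℤ - 1ℤ) - k * (1ℤ - 1ℤ)
    lem = solve-∀
  coeff-mul N k (suc n) = begin
    + suc n * (N * coeff N k n - k * coeff N (ℤ.pred k) n)
      ≡⟨ lem (+ suc n) N k (coeff N k n) (coeff N (ℤ.pred k) n) ⟩
    N * (+ suc n * coeff N k n) - k * (+ suc n * coeff N (ℤ.pred k) n)
      ≡⟨ cong₂ (λ x y → N * x - k * y) (coeff-suc N k n) (coeff-suc N (ℤ.pred k) n) ⟩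
    N * (coeff N k (suc n) - coeff N (ℤ.suc k) (suc n)) - k *
      (coeff N (ℤ.pred k) (suc n) - coeff N (ℤ.suc (ℤ.pred k)) (suc n))
      ≡⟨ cong (λ i → N * (coeff N k (suc n) - coeff N (ℤ.suc k) (suc n)) - k *
        (coeff N (ℤ.pred k) (suc n) - coeff N i (suc n))) (ℤₚ.suc-pred k) ⟩
    N * (coeff N k (suc n) - coeff N (ℤ.suc k) (suc n)) - k * (coeff N (ℤ.pred k) (suc n) - coeff N k (suc n)) ∎
    where
    lem : ∀ n N k x y → n * (N * x - k * y) ≡ N * (n * x) - k * (n * y)
    lem = solve-∀

  -- The binomial transform.

  -- The binomial transform Σ_j C(n,j) f(j), that is, multiplication by e^x; splitting on the first of n + 1
  -- points avoids binomial coefficients.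
  binomial : (ℕ → ℤ) → ℕ → ℤ
  binomial f zero = f 0
  binomial f (suc n) = binomial f n + binomial (λ j → f (suc j)) n

  binomial-cong : ∀ {f g} n → (∀ j → j ℕ.≤ n → f j ≡ g j) → binomial f n ≡ binomial g n
  binomial-cong zero f≗g = f≗g 0 ℕ.z≤n
  binomial-cong (suc n) f≗g = cong₂ _+_ (binomial-cong n (λ j j≤n → f≗g j (ℕₚ.m≤n⇒m≤1+n j≤n)))
                                 (binomial-cong n (λ j j≤n → f≗g (suc j) (ℕ.s≤s j≤n)))

  binomial-linear : ∀ a b f g n → binomial (λ j → a * f j + b * g j) n ≡ a * binomial f n + b * binomial g n
  binomial-linear a b f g zero = refl
  binomial-linear a b f g (suc n) = begin
    binomial (λ j → a * f j + b * g j) n + binomial (λ j → a * f (suc j) + b * g (suc j)) n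
      ≡⟨ cong₂ _+_ (binomial-linear a b f g n) (binomial-linear a b (λ j → f (suc j)) (λ j → g (suc j)) n) ⟩
    (a * binomial f n + b * binomial g n) + (a * binomial (λ j → f (suc j)) n + b * binomial (λ j → g (suc j)) n)
      ≡⟨ lem a b (binomial f n) (binomial g n) (binomial (λ j → f (suc j)) n) (binomial (λ j → g (suc j)) n) ⟩
    a * binomial f (suc n) + b * binomial g (suc n) ∎
    where
    lem : ∀ a b x y z w → (a * x + b * y) + (a * z + b * w) ≡ a * (x + z) + b * (y + w)
    lem = solve-∀

  binomial-scale : ∀ c f n → binomial (λ j → c * f j) n ≡ c * binomial f n
  binomial-scale c f zero = refl
  binomial-scale c f (suc n) = trans (cong₂ _+_ (binomial-scale c f n) (binomial-scale c (λ j → f (suc j)) n))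
    (sym (ℤₚ.*-distribˡ-+ c _ _))

  -- e^x · e^{Nx} = e^{(N+1)x}, with the power of 1 - x untouched. Shifting a sequence is
  -- differentiation, which brings in k - 1, so the induction keeps k general.
  binomial-coeff : ∀ N k n → binomial (coeff N k) n ≡ coeff (ℤ.suc N) k n
  binomial-coeff N k zero = refl
  binomial-coeff N k (suc n) = begin
    binomial (coeff N k) n + binomial (λ j → N * coeff N k j - k * coeff N (ℤ.pred k) j) n
      ≡⟨ cong (λ x → binomial (coeff N k) n + x) (binomial-cong n
        (λ j _ → cong (λ x → N * coeff N k j + x) (ℤₚ.neg-distribˡ-* k (coeff N (ℤ.pred k) j)))) ⟩
    binomial (coeff N k) n + binomial (λ j → N * coeff N k j + (- k) * coeff N (ℤ.pred k) j) n
      ≡⟨ cong (λ x → binomial (coeff N k) n + x) (binomial-linear N (- k) (coeff N k) (coeff N (ℤ.pred k)) n) ⟩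
    binomial (coeff N k) n + (N * binomial (coeff N k) n + (- k) * binomial (coeff N (ℤ.pred k)) n)
      ≡⟨ cong₂ (λ x y → x + (N * x + (- k) * y)) (binomial-coeff N k n) (binomial-coeff N (ℤ.pred k) n) ⟩
    coeff (ℤ.suc N) k n + (N * coeff (ℤ.suc N) k n + (- k) * coeff (ℤ.suc N) (ℤ.pred k) n)
      ≡⟨ lem N k (coeff (ℤ.suc N) k n) (coeff (ℤ.suc N) (ℤ.pred k) n) ⟩
    coeff (ℤ.suc N) k (suc n) ∎
    where
    lem : ∀ N k x y → x + (N * x + (- k) * y) ≡ (1ℤ + N) * x - k * y
    lem = solve-∀

  -- Laurent polynomials in 1 - x and the operator x d/dx.

  -- A list of pairs (c , k) stands for the Laurent polynomial Σ c (1 − x)^k.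
  Laurent : Set
  Laurent = List (ℤ × ℤ)

  -- φ supplies the value standing for each power of 1 - x. Keeping it abstract lets the ring solver
  -- check identities between Laurent polynomials with finitely many values of φ as variables.
  eval : Laurent → (ℤ → ℤ) → ℤ
  eval [] φ = 0ℤ
  eval ((c , k) ∷ cs) φ = c * φ k + eval cs φ

  binomial-eval : ∀ N cs n → binomial (λ j → eval cs (λ k → coeff N k j)) n ≡ eval cs (λ k → coeff (ℤ.suc N) k n)
  binomial-eval N [] n = binomial-zero n
    where
    binomial-zero : ∀ n → binomial (λ _ → 0ℤ) n ≡ 0ℤ
    binomial-zero zero = refl
    binomial-zero (suc n) = cong₂ _+_ (binomial-zero n) (binomial-zero n)
  binomial-eval N ((c , k) ∷ cs) n = begin
    binomial (λ j → c * coeff N k j + eval cs (λ k → coeff N k j)) n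
      ≡⟨ binomial-cong n (λ j _ → cong (λ x → c * coeff N k j + x) (ℤₚ.*-identityˡ _)) ⟨
    binomial (λ j → c * coeff N k j + 1ℤ * eval cs (λ k → coeff N k j)) n
      ≡⟨ binomial-linear c 1ℤ (coeff N k) _ n ⟩
    c * binomial (coeff N k) n + 1ℤ * binomial (λ j → eval cs (λ k → coeff N k j)) n
      ≡⟨ cong₂ (λ x y → c * x + y) (binomial-coeff N k n) (trans (ℤₚ.*-identityˡ _) (binomial-eval N cs n)) ⟩
    eval ((c , k) ∷ cs) (λ k → coeff (ℤ.suc N) k n) ∎

  δ : ℤ → (ℤ → ℤ) → ℤ → ℤ
  δ N φ k = N * (φ k - φ (ℤ.suc k)) - k * (φ (ℤ.pred k) - φ k)

  -- The operator x d/dx, which multiplies the n-th coefficient by n; δ is its transpose.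
  xD : ℤ → Laurent → Laurent
  xD N [] = []
  xD N ((c , k) ∷ cs) = (c * (N + k) , k) ∷ (- (c * N) , ℤ.suc k) ∷ (- (c * k) , ℤ.pred k) ∷ xD N cs

  eval-xD : ∀ N cs φ → eval (xD N cs) φ ≡ eval cs (δ N φ)
  eval-xD N [] φ = refl
  eval-xD N ((c , k) ∷ cs) φ = trans
    (lem c N k (φ k) (φ (ℤ.suc k)) (φ (ℤ.pred k)) (eval (xD N cs) φ))
    (cong (λ x → c * δ N φ k + x) (eval-xD N cs φ))
    where
    lem : ∀ c N k x y z w → c * (N + k) * x + (- (c * N) * y + (- (c * k) * z + w)) ≡
      c * (N * (x - y) - k * (z - x)) + w
    lem = solve-∀

  *-eval : ∀ a cs φ → a * eval cs φ ≡ eval cs (λ k → a * φ k)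
  *-eval a [] φ = ℤₚ.*-zeroʳ a
  *-eval a ((c , k) ∷ cs) φ = trans (lem a c (φ k) (eval cs φ)) (cong (λ x → c * (a * φ k) + x) (*-eval a cs φ))
    where
    lem : ∀ a c x y → a * (c * x + y) ≡ c * (a * x) + a * y
    lem = solve-∀

  eval-cong : ∀ cs {φ χ} → (∀ k → φ k ≡ χ k) → eval cs φ ≡ eval cs χ
  eval-cong [] φ≗χ = refl
  eval-cong ((c , k) ∷ cs) φ≗χ = cong₂ (λ x y → c * x + y) (φ≗χ k) (eval-cong cs φ≗χ)

  xD-eval : ∀ N cs n → + n * eval cs (λ k → coeff N k n) ≡ eval (xD N cs) (λ k → coeff N k n)
  xD-eval N cs n = trans (*-eval (+ n) cs φ)
    (trans (eval-cong cs (λ k → coeff-mul N k n)) (sym (eval-xD N cs φ)))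
    where
    φ = λ k → coeff N k n

  scale : ℤ → Laurent → Laurent
  scale a [] = []
  scale a ((c , k) ∷ cs) = (a * c , k) ∷ scale a cs

  eval-++-scale : ∀ cs a ds φ → eval (cs ++ scale a ds) φ ≡ eval cs φ + a * eval ds φ
  eval-++-scale [] a [] φ = sym (trans (ℤₚ.+-identityˡ _) (ℤₚ.*-zeroʳ a))
  eval-++-scale [] a ((d , k) ∷ ds) φ = trans (cong (λ x → a * d * φ k + x) (eval-++-scale [] a ds φ))
    (lem a d (φ k) (eval ds φ))
    where
    lem : ∀ a d x y → a * d * x + (0ℤ + a * y) ≡ 0ℤ + a * (d * x + y)
    lem = solve-∀
  eval-++-scale ((c , k) ∷ cs) a ds φ =
    trans (cong (λ x → c * φ k + x) (eval-++-scale cs a ds φ)) (sym (ℤₚ.+-assoc (c * φ k) _ _))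

  eval-++-scale-xD : ∀ N cs a ds n → eval (cs ++ scale a (xD N ds)) (λ k → coeff N k n) ≡
    eval cs (λ k → coeff N k n) + a * (+ n * eval ds (λ k → coeff N k n))
  eval-++-scale-xD N cs a ds n = trans (eval-++-scale cs a (xD N ds) (λ k → coeff N k n))
    (cong (λ x → eval cs (λ k → coeff N k n) + a * x) (sym (xD-eval N ds n)))

  -- Closed forms of the generating functions and their recursion in N.

  -- Multiplied by e^{Nx}, these are the generating functions of the sums of 1, 2 t and 12 t². The recursion in N
  -- fixes them up to a part independent of N, which the vanishing of the coefficient of index N determines
  -- (by Lagrange inversion).
  closed₀ : Laurent
  closed₀ = (1ℤ , + 1) ∷ []

  closed₁ : ℤ → Laurent
  closed₁ N = (1ℤ , - + 2) ∷ (- 1ℤ , - + 1) ∷ (1ℤ - + 2 * N , + 0) ∷ (N * N + N - 1ℤ , + 1) ∷ (N - N * N , + 2) ∷ []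

  closed₂ : ℤ → Laurent
  closed₂ N =
    (- + 48 , - + 5) ∷
    (+ 108 , - + 4) ∷
    (+ 24 * N - + 88 , - + 3) ∷
    (+ 6 * (N * N) - + 42 * N + + 34 , - + 2) ∷
    (+ 24 * N - + 12 * (N * N) - + 6 , - + 1) ∷
    (+ 12 * (N * N) - + 12 * (N * N * N) - + 2 , + 0) ∷
    (+ 3 * (N * N * N * N) + + 22 * (N * N * N) - + 27 * (N * N) + + 2 * N + + 2 , + 1) ∷
    (+ 18 * (N * N) - + 4 * (N * N * N) - + 6 * (N * N * N * N) - + 8 * N , + 2) ∷
    (+ 3 * (N * N * N * N) - + 6 * (N * N * N) + + 3 * (N * N) , + 3) ∷ []

  -- Replacing t by j + t adds j times the count, and a factor j acts as x d/dx; the normalisation 2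
  -- t accounts for the factor 2.
  closed₁-step : ∀ N φ → eval (closed₁ N ++ scale (+ 2) (xD N closed₀)) φ ≡ eval (closed₁ (ℤ.suc N)) φ
  closed₁-step N φ = trans (eval-++-scale (closed₁ N) (+ 2) (xD N closed₀) φ)
    (trans (cong (λ x → eval (closed₁ N) φ + + 2 * x) (eval-xD N closed₀ φ))
      (lem N (φ (- + 2)) (φ (- + 1)) (φ (+ 0)) (φ (+ 1)) (φ (+ 2))))
    where
    lem : ∀ N d e f g h →
      1ℤ * d + (- 1ℤ * e + ((1ℤ - + 2 * N) * f + ((N * N + N - 1ℤ) * g + ((N - N * N) * h + 0ℤ))))
      + + 2 * (1ℤ * (N * (g - h) - + 1 * (f - g)) + 0ℤ) ≡
      1ℤ * d + (- 1ℤ * e + ((1ℤ - + 2 * (1ℤ + N)) * f + (((1ℤ + N) * (1ℤ + N) + (1ℤ + N) - 1ℤ) * g + (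
      ((1ℤ + N) - (1ℤ + N) * (1ℤ + N)) * h + 0ℤ))))
    lem = solve-∀

  -- From (j + t)² = t² + j (2 t + j). Since `closed₁` already carries the factor 2, the increment
  -- is 12 x d/dx applied to the sum of `closed₁ N` and x d/dx of `closed₀`.
  closed₂-step : ∀ N φ →
    eval (closed₂ N ++ scale (+ 12) (xD N (closed₁ N ++ scale 1ℤ (xD N closed₀)))) φ ≡ eval (closed₂ (ℤ.suc N)) φ
  closed₂-step N φ = begin
    eval (closed₂ N ++ scale (+ 12) (xD N (closed₁ N ++ scale 1ℤ (xD N closed₀)))) φ
      ≡⟨ eval-++-scale (closed₂ N) (+ 12) (xD N (closed₁ N ++ scale 1ℤ (xD N closed₀))) φ ⟩
    eval (closed₂ N) φ + + 12 * eval (xD N (closed₁ N ++ scale 1ℤ (xD N closed₀))) φ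
      ≡⟨ cong (λ x → eval (closed₂ N) φ + + 12 * x) (trans (eval-xD N (closed₁ N ++ scale 1ℤ (xD N closed₀)) φ)
           (eval-++-scale (closed₁ N) 1ℤ (xD N closed₀) (δ N φ))) ⟩
    eval (closed₂ N) φ + + 12 * (eval (closed₁ N) (δ N φ) + 1ℤ * eval (xD N closed₀) (δ N φ))
      ≡⟨ cong (λ x → eval (closed₂ N) φ + + 12 * (eval (closed₁ N) (δ N φ) + 1ℤ * x)) (eval-xD N closed₀ (δ N φ)) ⟩
    eval (closed₂ N) φ + + 12 * (eval (closed₁ N) (δ N φ) + 1ℤ * eval closed₀ (δ N (δ N φ)))
      -- With `xD` moved onto φ as `δ`, a polynomial identity in N and nine values of φ remains.
      ≡⟨ lem N (φ (- + 5)) (φ (- + 4)) (φ (- + 3)) (φ (- + 2)) (φ (- + 1)) (φ (+ 0)) (φ (+ 1)) (φ (+ 2)) (φ (+ 3)) ⟩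
    eval (closed₂ (ℤ.suc N)) φ ∎
    where
    lem : ∀ N a b c d e f g h i →
      - + 48 * a + (+ 108 * b + ((+ 24 * N - + 88) * c + ((+ 6 * (N * N) - + 42 * N + + 34) * d + (
      (+ 24 * N - + 12 * (N * N) - + 6) * e + ((+ 12 * (N * N) - + 12 * (N * N * N) - + 2) * f + (
      (+ 3 * (N * N * N * N) + + 22 * (N * N * N) - + 27 * (N * N) + + 2 * N + + 2) * g + (
      (+ 18 * (N * N) - + 4 * (N * N * N) - + 6 * (N * N * N * N) - + 8 * N) * h + (
      (+ 3 * (N * N * N * N) - + 6 * (N * N * N) + + 3 * (N * N)) * i + 0ℤ))))))))
      + + 12 * (1ℤ * (N * (d - e) - - + 2 * (c - d)) + (- 1ℤ * (N * (e - f) - - + 1 * (d - e)) + (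
      (1ℤ - + 2 * N) * (N * (f - g) - + 0 * (e - f)) + ((N * N + N - 1ℤ) * (N * (g - h) - + 1 * (f - g)) + (
      (N - N * N) * (N * (h - i) - + 2 * (g - h)) + 0ℤ))))
      + 1ℤ * (1ℤ * (N * (N * (g - h) - + 1 * (f - g) - (N * (h - i) - + 2 * (g - h)))
        - + 1 * (N * (f - g) - + 0 * (e - f) - (N * (g - h) - + 1 * (f - g)))) + 0ℤ)) ≡
      - + 48 * a + (+ 108 * b + ((+ 24 * (1ℤ + N) - + 88) * c + (
      (+ 6 * ((1ℤ + N) * (1ℤ + N)) - + 42 * (1ℤ + N) + + 34) * d + (
      (+ 24 * (1ℤ + N) - + 12 * ((1ℤ + N) * (1ℤ + N)) - + 6) * e + (
      (+ 12 * ((1ℤ + N) * (1ℤ + N)) - + 12 * ((1ℤ + N) * (1ℤ + N) * (1ℤ + N)) - + 2) * f + (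
      (+ 3 * ((1ℤ + N) * (1ℤ + N) * (1ℤ + N) * (1ℤ + N)) + + 22 * ((1ℤ + N) * (1ℤ + N) * (1ℤ + N)) - + 27 *
        ((1ℤ + N) * (1ℤ + N)) + + 2 * (1ℤ + N) + + 2) * g + (
      (+ 18 * ((1ℤ + N) * (1ℤ + N)) - + 4 * ((1ℤ + N) * (1ℤ + N) * (1ℤ + N)) - + 6 *
        ((1ℤ + N) * (1ℤ + N) * (1ℤ + N) * (1ℤ + N)) - + 8 * (1ℤ + N)) * h + (
      (+ 3 * ((1ℤ + N) * (1ℤ + N) * (1ℤ + N) * (1ℤ + N)) - + 6 * ((1ℤ + N) * (1ℤ + N) * (1ℤ + N)) + + 3 *
        ((1ℤ + N) * (1ℤ + N))) * i + 0ℤ))))))))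
    lem = solve-∀

  -- Sums over lists.

  Σ : {A : Set} → (A → ℤ) → List A → ℤ
  Σ f xs = foldr _+_ 0ℤ (map f xs)

  Σ-++ : {A : Set} (f : A → ℤ) (xs ys : List A) → Σ f (xs ++ ys) ≡ Σ f xs + Σ f ys
  Σ-++ f [] ys = sym (ℤₚ.+-identityˡ _)
  Σ-++ f (x ∷ xs) ys = trans (cong (λ s → f x + s) (Σ-++ f xs ys)) (sym (ℤₚ.+-assoc (f x) _ _))

  Σ-map : {A C : Set} (f : C → ℤ) (g : A → C) (xs : List A) → Σ f (map g xs) ≡ Σ (f ∘ g) xs
  Σ-map f g xs = cong (foldr _+_ 0ℤ) (sym (Listₚ.map-∘ xs))

  Σ-concatMap : {A C : Set} (f : C → ℤ) (g : A → List C) (xs : List A) →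
    Σ f (concatMap g xs) ≡ Σ (λ x → Σ f (g x)) xs
  Σ-concatMap f g [] = refl
  Σ-concatMap f g (x ∷ xs) =
    trans (Σ-++ f (g x) (concatMap g xs)) (cong (λ s → Σ f (g x) + s) (Σ-concatMap f g xs))

  Σ-congᴬ : {A : Set} {P : A → Set} {f g : A → ℤ} {xs : List A} →
    (∀ {x} → P x → f x ≡ g x) → All P xs → Σ f xs ≡ Σ g xs
  Σ-congᴬ f≗g [] = refl
  Σ-congᴬ f≗g (px ∷ pxs) = cong₂ _+_ (f≗g px) (Σ-congᴬ f≗g pxs)

  Σ-cong : {A : Set} {f g : A → ℤ} → (∀ x → f x ≡ g x) → (xs : List A) → Σ f xs ≡ Σ g xs
  Σ-cong f≗g xs = cong (foldr _+_ 0ℤ) (Listₚ.map-cong f≗g xs)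

  Σ-linear : {A : Set} (a b : ℤ) (f g : A → ℤ) (xs : List A) →
    Σ (λ x → a * f x + b * g x) xs ≡ a * Σ f xs + b * Σ g xs
  Σ-linear a b f g [] = sym (cong₂ _+_ (ℤₚ.*-zeroʳ a) (ℤₚ.*-zeroʳ b))
  Σ-linear a b f g (x ∷ xs) = trans (cong (λ s → a * f x + b * g x + s) (Σ-linear a b f g xs))
    (lem a b (f x) (g x) (Σ f xs) (Σ g xs))
    where
    lem : ∀ a b x y s t → a * x + b * y + (a * s + b * t) ≡ a * (x + s) + b * (y + t)
    lem = solve-∀

  Σ-+ : {A : Set} (f g : A → ℤ) (xs : List A) → Σ (λ x → f x + g x) xs ≡ Σ f xs + Σ g xs
  Σ-+ f g [] = refl
  Σ-+ f g (x ∷ xs) = trans (cong (λ s → f x + g x + s) (Σ-+ f g xs))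
    (lem (f x) (g x) (Σ f xs) (Σ g xs))
    where
    lem : ∀ x y s t → x + y + (s + t) ≡ x + s + (y + t)
    lem = solve-∀

  Σ-filter : {A : Set} {P : A → Set} (P? : Decidable P) (f : A → ℤ) (xs : List A) →
    Σ f (filter P? xs) ≡ Σ (λ x → if does (P? x) then f x else 0ℤ) xs
  Σ-filter P? f [] = refl
  Σ-filter P? f (x ∷ xs) with does (P? x)
  ... | true = cong (λ s → f x + s) (Σ-filter P? f xs)
  ... | false = trans (Σ-filter P? f xs) (sym (ℤₚ.+-identityˡ _))

  -- Deleting the ones of a word.

  Positive : List ℕ → Set
  Positive = All (1 ℕ.≤_)

  -- A zero is treated like a one, in step with `peel`, so that `length-peel` and `excess-peel` hold
  -- for every word.
  ones : List ℕ → ℕ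
  ones [] = 0
  ones (suc (suc x) ∷ w) = ones w
  ones (_ ∷ w) = suc (ones w)

  peel : List ℕ → List ℕ
  peel [] = []
  peel (suc (suc x) ∷ w) = suc x ∷ peel w
  peel (_ ∷ w) = peel w

  -- The statistic t; on positive words of a fixed length, the area is a constant minus t.
  excess : List ℕ → ℕ
  excess [] = 0
  excess (x ∷ w) = ℕ.pred x ℕ.+ excess w

  -- The sorted word with k ones whose other entries, decreased by one, are s.
  raise : ℕ → List ℕ → List ℕ
  raise k s = replicate k 1 ++ map suc s

  insert-1-raise : ∀ k s → insert 1 (raise k s) ≡ raise (suc k) s
  insert-1-raise zero [] = refl
  insert-1-raise zero (y ∷ s) = refl
  insert-1-raise (suc k) s = refl

  insert-2+-raise : ∀ x k s → insert (suc (suc x)) (raise k s) ≡ raise k (insert (suc x) s)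
  insert-2+-raise x zero [] = refl
  -- `suc (suc x) ≤ᵇ suc y` and `suc x ≤ᵇ y` both reduce to `x <ᵇ y`, so one case split decides both
  -- insertions.
  insert-2+-raise x zero (y ∷ s) with x ℕ.<ᵇ y
  ... | true = refl
  ... | false = cong (suc y ∷_) (insert-2+-raise x zero s)
  insert-2+-raise x (suc k) s = cong (1 ∷_) (insert-2+-raise x k s)

  -- Ones head the sorted word, and decreasing the other entries keeps their order.
  sort-raise : ∀ {w} → Positive w → sort w ≡ raise (ones w) (sort (peel w))
  sort-raise [] = refl
  sort-raise {suc zero ∷ w} (_ ∷ pos) =
    trans (cong (insert 1) (sort-raise pos)) (insert-1-raise (ones w) (sort (peel w)))
  sort-raise {suc (suc x) ∷ w} (_ ∷ pos) =
    trans (cong (insert (suc (suc x))) (sort-raise pos)) (insert-2+-raise x (ones w) (sort (peel w)))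

  -- Threshold 1 gives the parking condition on a sorted word; other thresholds arise once ones are
  -- deleted.
  below : ℕ → List ℕ → Bool
  below a [] = true
  below a (x ∷ s) = (x ℕ.≤ᵇ a) ∧ below (suc a) s

  -- Each leading one passes and lifts the threshold by one; decreasing the remaining entries lowers
  -- it by one.
  below-raise : ∀ a k s → below (suc a) (raise k s) ≡ below (a ℕ.+ k) s
  below-raise a (suc k) s = trans (below-raise (suc a) k s) (cong (λ b → below b s) (sym (ℕₚ.+-suc a k)))
  below-raise a zero s = trans (shift a s) (cong (λ b → below b s) (sym (ℕₚ.+-identityʳ a)))
    where
    shift : ∀ a s → below (suc a) (map suc s) ≡ below a s
    shift a [] = refl
    shift a (zero ∷ s) = shift (suc a) s
    shift a (suc y ∷ s) = cong ((y ℕ.<ᵇ a) ∧_) (shift (suc a) s)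

  -- Only meaningful for length w ≤ suc m, where the subtraction is not truncated.
  parked : ℕ → List ℕ → Bool
  parked m w = below (suc m ℕ.∸ length w) (sort w)

  length-peel : ∀ w → length w ≡ ones w ℕ.+ length (peel w)
  length-peel [] = refl
  length-peel (zero ∷ w) = cong suc (length-peel w)
  length-peel (suc zero ∷ w) = cong suc (length-peel w)
  length-peel (suc (suc x) ∷ w) = trans (cong suc (length-peel w)) (sym (ℕₚ.+-suc (ones w) _))

  excess-peel : ∀ w → excess w ≡ length (peel w) ℕ.+ excess (peel w)
  excess-peel [] = refl
  excess-peel (zero ∷ w) = excess-peel w
  excess-peel (suc zero ∷ w) = excess-peel w
  excess-peel (suc (suc x) ∷ w) = cong suc (trans (cong (x ℕ.+_) (excess-peel w)) (lem x (length (peel w)) _))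
    where
    lem : ∀ x l e → x ℕ.+ (l ℕ.+ e) ≡ l ℕ.+ (x ℕ.+ e)
    lem x l e = trans (sym (ℕₚ.+-assoc x l e)) (trans (cong (ℕ._+ e) (ℕₚ.+-comm x l)) (ℕₚ.+-assoc l x e))

  -- The deleted ones lift the threshold by exactly the loss of length, and the decrease by one
  -- matches the smaller alphabet. The bound on `length w` keeps every truncated subtraction exact.
  parked-peel : ∀ m {w} → Positive w → length w ℕ.≤ suc m → parked (suc m) w ≡ parked m (peel w)
  parked-peel m {w} pos n≤ = begin
    below (suc (suc m) ℕ.∸ length w) (sort w)
      ≡⟨ cong₂ below (ℕₚ.+-∸-assoc 1 n≤) (sort-raise pos) ⟩
    below (suc (suc m ℕ.∸ length w)) (raise (ones w) (sort (peel w)))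
      ≡⟨ below-raise (suc m ℕ.∸ length w) (ones w) (sort (peel w)) ⟩
    below (suc m ℕ.∸ length w ℕ.+ ones w) (sort (peel w))
      ≡⟨ cong (λ a → below a (sort (peel w))) threshold ⟩
    below (suc m ℕ.∸ length (peel w)) (sort (peel w)) ∎
    where
    n≡ : length w ≡ length (peel w) ℕ.+ ones w
    n≡ = trans (length-peel w) (ℕₚ.+-comm (ones w) _)
    threshold : suc m ℕ.∸ length w ℕ.+ ones w ≡ suc m ℕ.∸ length (peel w)
    threshold = begin
      suc m ℕ.∸ length w ℕ.+ ones w ≡⟨ cong (λ n → suc m ℕ.∸ n ℕ.+ ones w) n≡ ⟩
      suc m ℕ.∸ (length (peel w) ℕ.+ ones w) ℕ.+ ones w
        ≡⟨ cong (ℕ._+ ones w) (ℕₚ.∸-+-assoc (suc m) (length (peel w)) (ones w)) ⟨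
      suc m ℕ.∸ length (peel w) ℕ.∸ ones w ℕ.+ ones w
        ≡⟨ ℕₚ.m∸n+n≡m (ℕₚ.m+n≤o⇒m≤o∸n (ones w) (subst (ℕ._≤ suc m) (length-peel w) n≤)) ⟩
      suc m ℕ.∸ length (peel w) ∎

  -- Sums over words and the recursion in the alphabet.

  words-spec : ∀ m n → All (λ w → Positive w × length w ≡ n) (words m n)
  words-spec m zero = ([] , refl) ∷ []
  words-spec m (suc n) = Allₚ.concat⁺ (Allₚ.map⁺ (All.map
    (λ {w} (pos , len) → Allₚ.map⁺ (Allₚ.applyUpTo⁺₂ suc m (λ i → s≤s z≤n ∷ pos , cong suc len)))
    (words-spec m n)))

  Σ-words-suc : ∀ m n (f : List ℕ → ℤ) →
    Σ f (words m (suc n)) ≡ Σ (λ w → Σ (λ x → f (x ∷ w)) (applyUpTo suc m)) (words m n)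
  Σ-words-suc m n f = trans (Σ-concatMap f _ (words m n))
    (Σ-cong (λ w → Σ-map f (_∷ w) (applyUpTo suc m)) (words m n))

  -- A word over the larger alphabet amounts to the set of positions of its non-ones together with
  -- its peeled word, so C(n, j) words lie over each peeled word of length j. The induction splits
  -- on the first letter: a one disappears, any other letter survives decreased.
  Σ-peel : ∀ m n (f : List ℕ → ℤ) → Σ (f ∘ peel) (words (suc m) n) ≡ binomial (λ j → Σ f (words m j)) n
  Σ-peel m zero f = refl
  Σ-peel m (suc n) f = begin
    Σ (f ∘ peel) (words (suc m) (suc n)) ≡⟨ Σ-words-suc (suc m) n (f ∘ peel) ⟩
    Σ (λ w → f (peel w) + Σ (λ x → f (peel (x ∷ w))) (applyUpTo (suc ∘ suc) m)) (words (suc m) n)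
      ≡⟨ Σ-cong (λ w → cong (λ s → f (peel w) + s) (shift w)) (words (suc m) n) ⟩
    Σ (λ w → f (peel w) + f⁺ (peel w)) (words (suc m) n) ≡⟨ Σ-+ (f ∘ peel) (f⁺ ∘ peel) (words (suc m) n) ⟩
    Σ (f ∘ peel) (words (suc m) n) + Σ (f⁺ ∘ peel) (words (suc m) n)
      ≡⟨ cong₂ _+_ (Σ-peel m n f) (Σ-peel m n f⁺) ⟩
    binomial (λ j → Σ f (words m j)) n + binomial (λ j → Σ f⁺ (words m j)) n
      ≡⟨ cong (λ s → binomial (λ j → Σ f (words m j)) n + s) (binomial-cong n (λ j _ → sym (Σ-words-suc m j f))) ⟩
    binomial (λ j → Σ f (words m j)) (suc n) ∎
    where
    f⁺ : List ℕ → ℤ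
    f⁺ u = Σ (λ x → f (x ∷ u)) (applyUpTo suc m)
    shift : ∀ w → Σ (λ x → f (peel (x ∷ w))) (applyUpTo (suc ∘ suc) m) ≡ f⁺ (peel w)
    shift w = trans (cong (Σ (λ x → f (peel (x ∷ w)))) (sym (Listₚ.map-applyUpTo suc suc m)))
      (trans (Σ-map _ suc (applyUpTo suc m)) (go (applyUpTo⁻ m)))
      where
      applyUpTo⁻ : ∀ m → All (1 ℕ.≤_) (applyUpTo suc m)
      applyUpTo⁻ m = Allₚ.applyUpTo⁺₂ suc m (λ i → s≤s z≤n)
      go : ∀ {xs} → All (1 ℕ.≤_) xs → Σ (λ x → f (peel (suc x ∷ w))) xs ≡ Σ (λ x → f (x ∷ peel w)) xs
      go = Σ-congᴬ λ { {suc x} _ → refl }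

  -- A conditional in place of a filter keeps the summation over all words, where `Σ-peel` applies.
  parkedSum : (ℤ → ℤ) → ℕ → ℕ → ℤ
  parkedSum ψ m n = Σ (λ w → if parked m w then ψ (+ excess w) else 0ℤ) (words m n)

  parkedSum-cong : ∀ {ψ χ} m n → (∀ t → ψ t ≡ χ t) → parkedSum ψ m n ≡ parkedSum χ m n
  parkedSum-cong m n ψ≗χ = Σ-cong (λ w → cong (λ x → if parked m w then x else 0ℤ) (ψ≗χ (+ excess w))) (words m n)

  parkedSum-linear : ∀ a b ψ χ m n → parkedSum (λ t → a * ψ t + b * χ t) m n ≡ a * parkedSum ψ m n
    + b * parkedSum χ m n
  parkedSum-linear a b ψ χ m n = trans (Σ-cong (λ w → distrib (parked m w) (+ excess w)) (words m n))
    (Σ-linear a b _ _ (words m n))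
    where
    distrib : ∀ c t → (if c then a * ψ t + b * χ t else 0ℤ) ≡
      a * (if c then ψ t else 0ℤ) + b * (if c then χ t else 0ℤ)
    distrib true t = refl
    distrib false t = sym (cong₂ _+_ (ℤₚ.*-zeroʳ a) (ℤₚ.*-zeroʳ b))

  -- `parked-peel` transports the condition, and `excess-peel` produces the shift by j, the length
  -- of the peeled word.
  parkedSum-peel : ∀ ψ m n → n ℕ.≤ suc m → parkedSum ψ (suc m) n ≡ binomial
    (λ j → parkedSum (λ t → ψ (+ j + t)) m j) n
  parkedSum-peel ψ m n n≤ = begin
    parkedSum ψ (suc m) n ≡⟨ Σ-congᴬ (λ {w} (pos , len) →
        cong₂ (λ c t → if c then ψ (+ t) else 0ℤ) (parked-peel m pos (subst (ℕ._≤ suc m) (sym len) n≤))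
          (excess-peel w))
      (words-spec (suc m) n) ⟩
    Σ (f ∘ peel) (words (suc m) n) ≡⟨ Σ-peel m n f ⟩
    binomial (λ j → Σ f (words m j)) n
      ≡⟨ binomial-cong n (λ j _ → Σ-congᴬ (λ {w} (pos , len) →
        cong (λ l → if parked m w then ψ (+ (l ℕ.+ excess w)) else 0ℤ) len) (words-spec m j)) ⟩
    binomial (λ j → parkedSum (λ t → ψ (+ j + t)) m j) n ∎
    where
    f : List ℕ → ℤ
    f u = if parked m u then ψ (+ (length u ℕ.+ excess u)) else 0ℤ

  -- Vanishing at the boundary length.

  insert-positive : ∀ {x s} → 1 ℕ.≤ x → Positive s → Positive (insert x s)
  insert-positive 1≤x [] = 1≤x ∷ []
  insert-positive {x} {y ∷ s} 1≤x (1≤y ∷ pos) with x ℕ.≤ᵇ y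
  ... | true = 1≤x ∷ 1≤y ∷ pos
  ... | false = 1≤y ∷ insert-positive 1≤x pos

  sort-positive : ∀ {w} → Positive w → Positive (sort w)
  sort-positive [] = []
  sort-positive (1≤x ∷ pos) = insert-positive 1≤x (sort-positive pos)

  below-0-insert : ∀ x {s} → Positive s → below 0 (insert (suc x) s) ≡ false
  below-0-insert x [] = refl
  below-0-insert x {suc y ∷ s} (_ ∷ pos) with x ℕ.<ᵇ suc y
  ... | true = refl
  ... | false = refl

  -- At this length the threshold is 0, which the least entry of a positive word exceeds.
  parkedSum-top : ∀ ψ m → parkedSum ψ m (suc m) ≡ 0ℤ
  parkedSum-top ψ m = trans (Σ-congᴬ {g = λ _ → 0ℤ} vanish (words-spec m (suc m))) (Σ-zero (words m (suc m)))
    where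
    vanish : ∀ {w} → Positive w × length w ≡ suc m → (if parked m w then ψ (+ excess w) else 0ℤ) ≡ 0ℤ
    vanish {suc x ∷ w} (_ ∷ pos , len) = cong (λ c → if c then ψ (+ excess (suc x ∷ w)) else 0ℤ)
      (trans (cong (λ a → below a (sort (suc x ∷ w))) (trans (cong (suc m ℕ.∸_) len) (ℕₚ.n∸n≡0 (suc m))))
             (below-0-insert x (sort-positive pos)))
    Σ-zero : ∀ {A : Set} (xs : List A) → Σ (λ _ → 0ℤ) xs ≡ 0ℤ
    Σ-zero [] = refl
    Σ-zero (_ ∷ xs) = trans (ℤₚ.+-identityˡ _) (Σ-zero xs)

  -- Relations among the coefficients of a fixed index.

  row : ℕ → ℕ → ℤ → ℤ
  row N n k = coeff (+ N) k n

  -- coeff-mul as a three-term recurrence in k at fixed n.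
  Relations : ℤ → ℤ → (ℤ → ℤ) → Set
  Relations N n φ = ∀ k → (N + k - n) * φ k - N * φ (ℤ.suc k) - k * φ (ℤ.pred k) ≡ 0ℤ

  row-relations : ∀ N n → Relations (+ N) (+ n) (row N n)
  row-relations N n k = trans (lem (+ N) (+ n) k _ _ _)
    (trans (cong (λ x → x - + n * row N n k) (sym (coeff-mul (+ N) k n))) (ℤₚ.+-inverseʳ (+ n * row N n k)))
    where
    lem : ∀ N n k x y z → (N + k - n) * x - N * y - k * z ≡ N * (x - y) - k * (z - x) - n * x
    lem = solve-∀

  -- The coefficients of e^{Nx} at x^{N-1} and x^N agree, since N^{N-1}/(N - 1)! = N^N/N!, so they
  -- cancel in e^{Nx} (1 - x).
  row-1-top : ∀ n → row (suc n) (suc n) (+ 1) ≡ 0ℤ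
  row-1-top n = trans (lem (+ suc n) (row (suc n) n (+ 0)) (row (suc n) n -[1+ 0 ]) _)
    (trans (cong (λ x → + suc n * row (suc n) n (+ 0) - x) (sym (coeff-suc (+ suc n) (+ 0) n)))
      (ℤₚ.+-inverseʳ (+ suc n * row (suc n) n (+ 0))))
    where
    lem : ∀ N x q y → y ≡ N * x - ((N * x - 0ℤ * q) - y)
    lem = solve-∀

  -- The relation at k = -1 eliminates φ(-2) and the one at k = 1, with multiplier N - 1, eliminates
  -- φ(2). What remains is N² φ(1).
  closed₁-top : ∀ N φ → Relations N N φ → φ (+ 1) ≡ 0ℤ → eval (closed₁ N) φ ≡ 0ℤ
  closed₁-top N φ rel φ₁≡0 = trans (lem N (φ (- + 2)) (φ (- + 1)) (φ (+ 0)) (φ (+ 1)) (φ (+ 2)))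
    (begin
      _ ≡⟨ cong₂ (λ x y → x + (N - 1ℤ) * y + (N * N) * φ (+ 1)) (rel (- + 1)) (rel (+ 1)) ⟩
      0ℤ + (N - 1ℤ) * 0ℤ + N * N * φ (+ 1) ≡⟨ cong (λ x → 0ℤ + (N - 1ℤ) * 0ℤ + N * N * x) φ₁≡0 ⟩
      0ℤ + (N - 1ℤ) * 0ℤ + N * N * 0ℤ ≡⟨ lem₀ N ⟩
      0ℤ ∎)
    where
    lem₀ : ∀ N → 0ℤ + (N - 1ℤ) * 0ℤ + N * N * 0ℤ ≡ 0ℤ
    lem₀ = solve-∀
    lem : ∀ N d e f g h →
      1ℤ * d + (- 1ℤ * e + ((1ℤ - + 2 * N) * f + ((N * N + N - 1ℤ) * g + ((N - N * N) * h + 0ℤ)))) ≡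
      ((N + - + 1 - N) * e - N * f - - + 1 * d)
      + (N - 1ℤ) * ((N + + 1 - N) * g - N * h - + 1 * f) + (N * N) * g
    lem = solve-∀

  -- Elimination inwards from both ends: the relations at k = -4, ..., -1 remove φ(-5), ..., φ(-2),
  -- and those at k = 2 and 1 remove φ(3) and φ(2). Then φ(-1) and φ(0) cancel, leaving a multiple
  -- of φ(1). The coefficients in `comb` are the multipliers found in this way.
  closed₂-top : ∀ N φ → Relations N N φ → φ (+ 1) ≡ 0ℤ → eval (closed₂ N) φ ≡ 0ℤ
  closed₂-top N φ rel φ₁≡0 = trans (lem N (φ (- + 5)) (φ (- + 4)) (φ (- + 3)) (φ (- + 2)) (φ (- + 1)) (φ (+ 0))
    (φ (+ 1)) (φ (+ 2)) (φ (+ 3)))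
    (trans (lem′ (rel (- + 4)) (rel (- + 3)) (rel (- + 2)) (rel (- + 1)) (rel (+ 1)) (rel (+ 2)) φ₁≡0) (lem₀ N))
    where
    comb : (a b c d e f g : ℤ) → ℤ
    comb a b c d e f g =
      - + 12 * a + + 20 * b + (+ 6 * N - + 14) * c + (+ 6 * (N * N) - + 10 * N + + 6) * d
      + (+ 6 * (N * N * N) - + 2 * (N * N) - + 6 * N + + 2) * e
      + (+ 6 * (N * N) - + 3 * (N * N * N) - + 3 * N) * f
      + (+ 3 * (N * N * N * N) + + 10 * (N * N * N) - + 13 * (N * N) + + 2 * N) * g
    lem′ : ∀ {a b c d e f g} → a ≡ 0ℤ → b ≡ 0ℤ → c ≡ 0ℤ → d ≡ 0ℤ → e ≡ 0ℤ → f ≡ 0ℤ → g ≡ 0ℤ →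
      comb a b c d e f g ≡ comb 0ℤ 0ℤ 0ℤ 0ℤ 0ℤ 0ℤ 0ℤ
    lem′ refl refl refl refl refl refl refl = refl
    lem₀ : ∀ N → - + 12 * 0ℤ + + 20 * 0ℤ + (+ 6 * N - + 14) * 0ℤ + (+ 6 * (N * N) - + 10 * N + + 6) * 0ℤ
      + (+ 6 * (N * N * N) - + 2 * (N * N) - + 6 * N + + 2) * 0ℤ
      + (+ 6 * (N * N) - + 3 * (N * N * N) - + 3 * N) * 0ℤ
      + (+ 3 * (N * N * N * N) + + 10 * (N * N * N) - + 13 * (N * N) + + 2 * N) * 0ℤ ≡ 0ℤ
    lem₀ = solve-∀
    lem : ∀ N a b c d e f g h i →
      - + 48 * a + (+ 108 * b + ((+ 24 * N - + 88) * c + ((+ 6 * (N * N) - + 42 * N + + 34) * d +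
      ((+ 24 * N - + 12 * (N * N) - + 6) * e + ((+ 12 * (N * N) - + 12 * (N * N * N) - + 2) * f +
      ((+ 3 * (N * N * N * N) + + 22 * (N * N * N) - + 27 * (N * N) + + 2 * N + + 2) * g +
      ((+ 18 * (N * N) - + 4 * (N * N * N) - + 6 * (N * N * N * N) - + 8 * N) * h +
      ((+ 3 * (N * N * N * N) - + 6 * (N * N * N) + + 3 * (N * N)) * i + 0ℤ)))))))) ≡
      - + 12 * ((N + - + 4 - N) * b - N * c - - + 4 * a)
      + + 20 * ((N + - + 3 - N) * c - N * d - - + 3 * b)
      + (+ 6 * N - + 14) * ((N + - + 2 - N) * d - N * e - - + 2 * c)
      + (+ 6 * (N * N) - + 10 * N + + 6) * ((N + - + 1 - N) * e - N * f - - + 1 * d)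
      + (+ 6 * (N * N * N) - + 2 * (N * N) - + 6 * N + + 2) * ((N + + 1 - N) * g - N * h - + 1 * f)
      + (+ 6 * (N * N) - + 3 * (N * N * N) - + 3 * N) * ((N + + 2 - N) * h - N * i - + 2 * g)
      + (+ 3 * (N * N * N * N) + + 10 * (N * N * N) - + 13 * (N * N) + + 2 * N) * g
    lem = solve-∀

  -- Closed forms of the moments, by induction on the alphabet.

  one : ℤ → ℤ
  one _ = 1ℤ

  -- Peeling is multiplication by e^x, which keeps the Laurent polynomial and raises the exponent
  -- from m + 1 to m + 2. The factor c clears denominators.
  parkedSum-step : ∀ c ψ m n cs → n ℕ.≤ suc m →
    (∀ j → j ℕ.≤ suc m → c * parkedSum (λ t → ψ (+ j + t)) m j ≡ eval cs (row (suc m) j)) →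
    c * parkedSum ψ (suc m) n ≡ eval cs (row (suc (suc m)) n)
  parkedSum-step c ψ m n cs n≤ shifted = begin
    c * parkedSum ψ (suc m) n ≡⟨ cong (c *_) (parkedSum-peel ψ m n n≤) ⟩
    c * binomial (λ j → parkedSum (λ t → ψ (+ j + t)) m j) n ≡⟨ binomial-scale c _ n ⟨
    binomial (λ j → c * parkedSum (λ t → ψ (+ j + t)) m j) n
      ≡⟨ binomial-cong n (λ j j≤n → shifted j (ℕₚ.≤-trans j≤n n≤)) ⟩
    binomial (λ j → eval cs (row (suc m) j)) n ≡⟨ binomial-eval (+ suc m) cs n ⟩
    eval cs (row (suc (suc m)) n) ∎

  -- Induction on m. The boundary n = m + 1, where both sides vanish, is treated apart and belongs
  -- to the claim because the recursion for the next alphabet reaches it.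
  moment₀ : ∀ m n → n ℕ.≤ suc m → + 1 * parkedSum one m n ≡ eval closed₀ (row (suc m) n)
  moment₁ : ∀ m n → n ℕ.≤ suc m → + 2 * parkedSum (λ t → t) m n ≡ eval (closed₁ (+ suc m)) (row (suc m) n)
  moment₂ : ∀ m n → n ℕ.≤ suc m → + 12 * parkedSum (λ t → t * t) m n ≡ eval (closed₂ (+ suc m)) (row (suc m) n)

  moment₀ m n n≤ with ℕₚ.m≤n⇒m<n∨m≡n n≤
  ... | inj₂ refl = trans (cong (+ 1 *_) (parkedSum-top one m))
    (sym (trans (ℤₚ.+-identityʳ _) (trans (ℤₚ.*-identityˡ _) (row-1-top m))))
  moment₀ zero .0 _ | inj₁ (s≤s z≤n) = refl
  moment₀ (suc m) n _ | inj₁ (s≤s n≤) = parkedSum-step (+ 1) one m n closed₀ n≤ (moment₀ m)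

  moment₁ m n n≤ with ℕₚ.m≤n⇒m<n∨m≡n n≤
  ... | inj₂ refl = trans (cong (+ 2 *_) (parkedSum-top (λ t → t) m))
    (sym (closed₁-top (+ suc m) _ (row-relations (suc m) (suc m)) (row-1-top m)))
  moment₁ zero .0 _ | inj₁ (s≤s z≤n) = refl
  moment₁ (suc m) n _ | inj₁ (s≤s n≤) =
    trans (parkedSum-step (+ 2) (λ t → t) m n (closed₁ N ++ scale (+ 2) (xD N closed₀)) n≤ shifted)
      (closed₁-step N (row (suc (suc m)) n))
    where
    N = + suc m
    lem : ∀ j x y → + 2 * (j * x + 1ℤ * y) ≡ + 2 * y + + 2 * (j * (+ 1 * x))
    lem = solve-∀
    shifted : ∀ j → j ℕ.≤ suc m → + 2 * parkedSum (λ t → + j + t) m j ≡ eval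
      (closed₁ N ++ scale (+ 2) (xD N closed₀)) (row (suc m) j)
    shifted j j≤ = begin
      + 2 * parkedSum (λ t → + j + t) m j
        ≡⟨ cong (+ 2 *_) (parkedSum-cong m j λ t → cong₂ _+_ (sym (ℤₚ.*-identityʳ (+ j))) (sym (ℤₚ.*-identityˡ t))) ⟩
      + 2 * parkedSum (λ t → + j * one t + 1ℤ * t) m j
        ≡⟨ cong (+ 2 *_) (parkedSum-linear (+ j) 1ℤ one (λ t → t) m j) ⟩
      + 2 * (+ j * parkedSum one m j + 1ℤ * parkedSum (λ t → t) m j)
        ≡⟨ lem (+ j) (parkedSum one m j) (parkedSum (λ t → t) m j) ⟩
      + 2 * parkedSum (λ t → t) m j + + 2 * (+ j * (+ 1 * parkedSum one m j))
        ≡⟨ cong₂ (λ x y → x + + 2 * (+ j * y)) (moment₁ m j j≤) (moment₀ m j j≤) ⟩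
      eval (closed₁ N) (row (suc m) j) + + 2 * (+ j * eval closed₀ (row (suc m) j))
        ≡⟨ eval-++-scale-xD N (closed₁ N) (+ 2) closed₀ j ⟨
      eval (closed₁ N ++ scale (+ 2) (xD N closed₀)) (row (suc m) j) ∎

  moment₂ m n n≤ with ℕₚ.m≤n⇒m<n∨m≡n n≤
  ... | inj₂ refl = trans (cong (+ 12 *_) (parkedSum-top (λ t → t * t) m))
    (sym (closed₂-top (+ suc m) _ (row-relations (suc m) (suc m)) (row-1-top m)))
  moment₂ zero .0 _ | inj₁ (s≤s z≤n) = refl
  moment₂ (suc m) n _ | inj₁ (s≤s n≤) =
    trans (parkedSum-step (+ 12) (λ t → t * t) m n (closed₂ N ++ scale (+ 12) (xD N G)) n≤ shifted)
      (closed₂-step N (row (suc (suc m)) n))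
    where
    N = + suc m
    G = closed₁ N ++ scale 1ℤ (xD N closed₀)
    lem₁ : ∀ j t → (j + t) * (j + t) ≡ 1ℤ * (t * t) + j * (+ 2 * t + j * 1ℤ)
    lem₁ = solve-∀
    lem₂ : ∀ j x y z → + 12 * (1ℤ * z + j * (+ 2 * y + j * x)) ≡ + 12 * z + + 12 *
      (j * (+ 2 * y + 1ℤ * (j * (+ 1 * x))))
    lem₂ = solve-∀
    shifted : ∀ j → j ℕ.≤ suc m → + 12 * parkedSum (λ t → (+ j + t) * (+ j + t)) m j ≡ eval
      (closed₂ N ++ scale (+ 12) (xD N G)) (row (suc m) j)
    shifted j j≤ = begin
      + 12 * parkedSum (λ t → (+ j + t) * (+ j + t)) m j ≡⟨ cong (+ 12 *_) (parkedSum-cong m j (lem₁ (+ j))) ⟩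
      + 12 * parkedSum (λ t → 1ℤ * (t * t) + + j * (+ 2 * t + + j * one t)) m j
        ≡⟨ cong (+ 12 *_) (parkedSum-linear 1ℤ (+ j) (λ t → t * t) (λ t → + 2 * t + + j * one t) m j) ⟩
      + 12 * (1ℤ * parkedSum (λ t → t * t) m j + + j * parkedSum (λ t → + 2 * t + + j * one t) m j)
        ≡⟨ cong (λ x → + 12 * (1ℤ * parkedSum (λ t → t * t) m j + + j * x))
          (parkedSum-linear (+ 2) (+ j) (λ t → t) one m j) ⟩
      + 12 * (1ℤ * parkedSum (λ t → t * t) m j + + j * (+ 2 * parkedSum (λ t → t) m j + + j * parkedSum one m j))
        ≡⟨ lem₂ (+ j) (parkedSum one m j) (parkedSum (λ t → t) m j) (parkedSum (λ t → t * t) m j) ⟩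
      + 12 * parkedSum (λ t → t * t) m j + + 12 * (+ j *
        (+ 2 * parkedSum (λ t → t) m j + 1ℤ * (+ j * (+ 1 * parkedSum one m j))))
        ≡⟨ cong₂ (λ x y → x + + 12 * (+ j * (y + 1ℤ * (+ j * (+ 1 * parkedSum one m j))))) (moment₂ m j j≤)
          (moment₁ m j j≤) ⟩
      eval (closed₂ N) (row (suc m) j) + + 12 * (+ j *
        (eval (closed₁ N) (row (suc m) j) + 1ℤ * (+ j * (+ 1 * parkedSum one m j))))
        ≡⟨ cong (λ x → eval (closed₂ N) (row (suc m) j) + + 12 *
          (+ j * (eval (closed₁ N) (row (suc m) j) + 1ℤ * (+ j * x)))) (moment₀ m j j≤) ⟩
      eval (closed₂ N) (row (suc m) j) + + 12 * (+ j *
        (eval (closed₁ N) (row (suc m) j) + 1ℤ * (+ j * eval closed₀ (row (suc m) j))))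
        ≡⟨ cong (λ x → eval (closed₂ N) (row (suc m) j) + + 12 * (+ j * x))
          (eval-++-scale-xD N (closed₁ N) 1ℤ closed₀ j) ⟨
      eval (closed₂ N) (row (suc m) j) + + 12 * (+ j * eval G (row (suc m) j))
        ≡⟨ eval-++-scale-xD N (closed₂ N) (+ 12) G j ⟨
      eval (closed₂ N ++ scale (+ 12) (xD N G)) (row (suc m) j) ∎

  -- Parking functions and the area statistic.

  length-insert : ∀ x s → length (insert x s) ≡ suc (length s)
  length-insert x [] = refl
  length-insert x (y ∷ s) with x ℕ.≤ᵇ y
  ... | true = refl
  ... | false = cong suc (length-insert x s)

  length-sort : ∀ w → length (sort w) ≡ length w
  length-sort [] = refl
  length-sort (x ∷ w) = trans (length-insert x (sort w)) (cong suc (length-sort w))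

  does-isParking? : ∀ n {w} → Positive w → length w ≡ n → does (isParking? w) ≡ parked n w
  does-isParking? n {w} pos len = begin
    does (all? (1 ℕₚ.≤?_) w) ∧ does (all? ≤? (zip (sort w) (applyUpTo suc (length w))))
      ≡⟨ cong₂ _∧_ (dec-true (all? (1 ℕₚ.≤?_) w) pos)
        (cong (λ l → does (all? ≤? (zip (sort w) (applyUpTo suc l)))) (sym (length-sort w))) ⟩
    does (all? ≤? (zip (sort w) (applyUpTo suc (length (sort w))))) ≡⟨ below-zip 1 (sort w) suc (λ _ → refl) ⟩
    below 1 (sort w) ≡⟨ cong (λ a → below a (sort w)) (trans (cong (suc n ℕ.∸_) len) (ℕₚ.m+n∸n≡m 1 n)) ⟨
    parked n w ∎
    where
    ≤? = λ (xi : ℕ × ℕ) → proj₁ xi ℕₚ.≤? proj₂ xi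
    -- A general f is required by the induction, as unfolding `applyUpTo` turns f into `f ∘ suc`.
    below-zip : ∀ a s f → (∀ i → f i ≡ a ℕ.+ i) → does (all? ≤? (zip s (applyUpTo f (length s)))) ≡ below a s
    below-zip a [] f f≗ = refl
    below-zip a (x ∷ s) f f≗ = cong₂ (λ b c → (x ℕ.≤ᵇ b) ∧ c) (trans (f≗ 0) (ℕₚ.+-identityʳ a))
      (below-zip (suc a) s (f ∘ suc) (λ i → trans (f≗ (suc i)) (ℕₚ.+-suc a i)))

  sum-excess : ∀ {w} → Positive w → sumℕ w ≡ length w ℕ.+ excess w
  sum-excess [] = refl
  sum-excess {suc x ∷ w} (_ ∷ pos) = cong suc (trans (cong (x ℕ.+_) (sum-excess pos)) (lem x (length w) (excess w)))
    where
    lem : ∀ x l e → x ℕ.+ (l ℕ.+ e) ≡ l ℕ.+ (x ℕ.+ e)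
    lem = ℕ-Ring.solve-∀

  Σ-parking : ∀ n (f : List ℕ → ℤ) ψ → (∀ {w} → Positive w → length w ≡ n → f w ≡ ψ (+ excess w)) →
    Σ f (parkingFunctions n) ≡ parkedSum ψ n n
  Σ-parking n f ψ f≗ψ = trans (Σ-filter isParking? f (words n n))
    (Σ-congᴬ (λ (pos , len) → cong₂ (λ c x → if c then x else 0ℤ) (does-isParking? n pos len) (f≗ψ pos len))
      (words-spec n n))

  parkingCount : ∀ n → Σ (λ _ → 1ℤ) (parkingFunctions n) ≡ parkedSum one n n
  parkingCount n = Σ-parking n _ one (λ _ _ → refl)

  -- The area n(n - 1)/2 of the all-ones word, from which t is subtracted.
  offset : ℕ → ℤ
  offset n = + (n ℕ.* suc n ℕ./ 2) - + n

  2*offset : ∀ n → + 2 * offset n ≡ + n * (+ n - 1ℤ)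
  2*offset n = begin
    + 2 * (+ (n ℕ.* suc n ℕ./ 2) - + n) ≡⟨ lem₁ (+ (n ℕ.* suc n ℕ./ 2)) (+ n) ⟩
    + (n ℕ.* suc n ℕ./ 2) * + 2 - + 2 * + n ≡⟨ cong (λ x → x - + 2 * + n) (ℤₚ.pos-* (n ℕ.* suc n ℕ./ 2) 2) ⟨
    + (n ℕ.* suc n ℕ./ 2 ℕ.* 2) - + 2 * + n ≡⟨ cong (λ x → + x - + 2 * + n) (ℕ/.m/n*n≡m (2∣ n)) ⟩
    + (n ℕ.* suc n) - + 2 * + n ≡⟨ cong (λ x → x - + 2 * + n) (ℤₚ.pos-* n (suc n)) ⟩
    + n * (1ℤ + + n) - + 2 * + n ≡⟨ lem₂ (+ n) ⟩
    + n * (+ n - 1ℤ) ∎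
    where
    open import Data.Nat.Divisibility using (_∣_; divides)
    lem₁ : ∀ x y → + 2 * (x - y) ≡ x * + 2 - + 2 * y
    lem₁ = solve-∀
    lem₂ : ∀ n → n * (1ℤ + n) - + 2 * n ≡ n * (n - 1ℤ)
    lem₂ = solve-∀
    -- Triangular numbers witness that n (n + 1) is even, so the division in `area` is exact.
    triangle : ℕ → ℕ
    triangle zero = 0
    triangle (suc n) = suc n ℕ.+ triangle n
    2∣ : ∀ n → 2 ∣ n ℕ.* suc n
    2∣ n = divides (triangle n) (go n)
      where
      lem : ∀ n → (1 ℕ.+ n) ℕ.* (2 ℕ.+ n) ≡ 2 ℕ.* (1 ℕ.+ n) ℕ.+ n ℕ.* (1 ℕ.+ n)
      lem = ℕ-Ring.solve-∀
      lem′ : ∀ n t → 2 ℕ.* (1 ℕ.+ n) ℕ.+ t ℕ.* 2 ≡ (1 ℕ.+ n ℕ.+ t) ℕ.* 2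
      lem′ = ℕ-Ring.solve-∀
      go : ∀ n → n ℕ.* suc n ≡ triangle n ℕ.* 2
      go zero = refl
      go (suc n) = trans (lem n) (trans (cong (2 ℕ.* (1 ℕ.+ n) ℕ.+_) (go n)) (lem′ n (triangle n)))

  areaTotal : ℕ → ℤ
  areaTotal n = Σ (λ p → area n p * (area n p - 1ℤ)) (parkingFunctions n)

  areaTotal-parkedSum : ∀ n → areaTotal n ≡ 1ℤ * parkedSum (λ t → t * t) n n +
    1ℤ * ((1ℤ - + 2 * offset n) * parkedSum (λ t → t) n n + (offset n * offset n - offset n) * parkedSum one n n)
  areaTotal-parkedSum n = begin
    areaTotal n ≡⟨ Σ-parking n _ ψ (λ {w} pos len → cong (λ a → a * (a - 1ℤ)) (area-excess pos len)) ⟩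
    parkedSum ψ n n ≡⟨ parkedSum-cong n n (expand (offset n)) ⟩
    parkedSum (λ t → 1ℤ * (t * t) + 1ℤ * ((1ℤ - + 2 * offset n) * t + (offset n * offset n - offset n) * one t)) n n
      ≡⟨ parkedSum-linear 1ℤ 1ℤ (λ t → t * t) (λ t → (1ℤ - + 2 * c) * t + (c * c - c) * one t) n n ⟩
    1ℤ * parkedSum (λ t → t * t) n n + 1ℤ * parkedSum (λ t → (1ℤ - + 2 * c) * t + (c * c - c) * one t) n n
      ≡⟨ cong (λ x → 1ℤ * parkedSum (λ t → t * t) n n + 1ℤ * x)
        (parkedSum-linear (1ℤ - + 2 * c) (c * c - c) (λ t → t) one n n) ⟩
    1ℤ * parkedSum (λ t → t * t) n n + 1ℤ * ((1ℤ - + 2 * c) * parkedSum (λ t → t) n n +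
      (c * c - c) * parkedSum one n n) ∎
    where
    c = offset n
    ψ : ℤ → ℤ
    ψ t = (offset n - t) * (offset n - t - 1ℤ)
    expand : ∀ c t → (c - t) * (c - t - 1ℤ) ≡ 1ℤ * (t * t) + 1ℤ * ((1ℤ - + 2 * c) * t + (c * c - c) * 1ℤ)
    expand = solve-∀
    regroup : ∀ a l t → a - (l + t) ≡ a - l - t
    regroup = solve-∀
    area-excess : ∀ {w} → Positive w → length w ≡ n → area n w ≡ offset n - + excess w
    area-excess {w} pos len = begin
      + (n ℕ.* suc n ℕ./ 2) - + sumℕ w
        ≡⟨ cong (λ s → + (n ℕ.* suc n ℕ./ 2) - + s) (trans (sum-excess pos) (cong (ℕ._+ excess w) len)) ⟩
      + (n ℕ.* suc n ℕ./ 2) - (+ n + + excess w) ≡⟨ regroup (+ (n ℕ.* suc n ℕ./ 2)) (+ n) (+ excess w) ⟩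
      offset n - + excess w ∎

  -- Reduction at the index N - 1.

  closed₁-subtop : ∀ N φ → Relations N (N - 1ℤ) φ → eval (closed₁ N) φ ≡ (N * N - N + 1ℤ) * φ (+ 1) - φ (- + 1)
  closed₁-subtop N φ rel = trans (lem N (φ (- + 2)) (φ (- + 1)) (φ (+ 0)) (φ (+ 1)) (φ (+ 2)))
    (trans (cong₂ (λ x y → x + (N - 1ℤ) * y + ((N * N - N + 1ℤ) * φ (+ 1) - φ (- + 1))) (rel (- + 1)) (rel (+ 1)))
      (lem₀ N _))
    where
    lem₀ : ∀ N x → 0ℤ + (N - 1ℤ) * 0ℤ + x ≡ x
    lem₀ = solve-∀
    lem : ∀ N d e f g h →
      1ℤ * d + (- 1ℤ * e + ((1ℤ - + 2 * N) * f + ((N * N + N - 1ℤ) * g + ((N - N * N) * h + 0ℤ)))) ≡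
      ((N + - + 1 - (N - 1ℤ)) * e - N * f - - + 1 * d)
      + (N - 1ℤ) * ((N + + 1 - (N - 1ℤ)) * g - N * h - + 1 * f) + ((N * N - N + 1ℤ) * g - e)
    lem = solve-∀

  -- Elimination from both ends as in `closed₂-top`. The relation at k = 0 now reads φ(0) = N φ(1)
  -- and removes φ(0); its coefficient at φ(-1) is zero, so φ(-1) survives as a second unknown.
  closed₂-subtop : ∀ N φ → Relations N (N - 1ℤ) φ → eval (closed₂ N) φ ≡
    (+ 3 * (N * N * N * N) - N * N * N + + 9 * (N * N) - + 7 * N + + 4) * φ (+ 1)
    - (+ 6 * (N * N) - + 4 * N + + 6) * φ (- + 1)
  closed₂-subtop N φ rel = trans (lem N (φ (- + 5)) (φ (- + 4)) (φ (- + 3)) (φ (- + 2)) (φ (- + 1)) (φ (+ 0))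
    (φ (+ 1)) (φ (+ 2)) (φ (+ 3)))
    (trans (lem′ (rel (- + 4)) (rel (- + 3)) (rel (- + 2)) (rel (- + 1)) (rel (+ 0)) (rel (+ 1)) (rel (+ 2)))
      (lem₀ N _))
    where
    comb : (a b c d z e f g : ℤ) → ℤ
    comb a b c d z e f g =
      - + 12 * a + + 24 * b + (+ 6 * N - + 20) * c + (+ 6 * (N * N) - + 12 * N + + 14) * d
      + (+ 14 * N - + 5 * (N * N) - + 3) * z
      + (+ 6 * (N * N * N) - + 5 * (N * N) - 1ℤ) * e
      + (+ 6 * (N * N) - + 3 * (N * N * N) - + 3 * N) * f + g
    lem′ : ∀ {a b c d z e f g} → a ≡ 0ℤ → b ≡ 0ℤ → c ≡ 0ℤ → d ≡ 0ℤ → z ≡ 0ℤ → e ≡ 0ℤ → f ≡ 0ℤ →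
      comb a b c d z e f g ≡ comb 0ℤ 0ℤ 0ℤ 0ℤ 0ℤ 0ℤ 0ℤ g
    lem′ refl refl refl refl refl refl refl = refl
    lem₀ : ∀ N g → - + 12 * 0ℤ + + 24 * 0ℤ + (+ 6 * N - + 20) * 0ℤ + (+ 6 * (N * N) - + 12 * N + + 14) * 0ℤ
      + (+ 14 * N - + 5 * (N * N) - + 3) * 0ℤ
      + (+ 6 * (N * N * N) - + 5 * (N * N) - 1ℤ) * 0ℤ
      + (+ 6 * (N * N) - + 3 * (N * N * N) - + 3 * N) * 0ℤ + g ≡ g
    lem₀ = solve-∀
    lem : ∀ N a b c d e f g h i →
      - + 48 * a + (+ 108 * b + ((+ 24 * N - + 88) * c + ((+ 6 * (N * N) - + 42 * N + + 34) * d +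
      ((+ 24 * N - + 12 * (N * N) - + 6) * e + ((+ 12 * (N * N) - + 12 * (N * N * N) - + 2) * f +
      ((+ 3 * (N * N * N * N) + + 22 * (N * N * N) - + 27 * (N * N) + + 2 * N + + 2) * g +
      ((+ 18 * (N * N) - + 4 * (N * N * N) - + 6 * (N * N * N * N) - + 8 * N) * h +
      ((+ 3 * (N * N * N * N) - + 6 * (N * N * N) + + 3 * (N * N)) * i + 0ℤ)))))))) ≡
      - + 12 * ((N + - + 4 - (N - 1ℤ)) * b - N * c - - + 4 * a)
      + + 24 * ((N + - + 3 - (N - 1ℤ)) * c - N * d - - + 3 * b)
      + (+ 6 * N - + 20) * ((N + - + 2 - (N - 1ℤ)) * d - N * e - - + 2 * c)
      + (+ 6 * (N * N) - + 12 * N + + 14) * ((N + - + 1 - (N - 1ℤ)) * e - N * f - - + 1 * d)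
      + (+ 14 * N - + 5 * (N * N) - + 3) * ((N + + 0 - (N - 1ℤ)) * f - N * g - 0ℤ * e)
      + (+ 6 * (N * N * N) - + 5 * (N * N) - 1ℤ) * ((N + + 1 - (N - 1ℤ)) * g - N * h - + 1 * f)
      + (+ 6 * (N * N) - + 3 * (N * N * N) - + 3 * N) * ((N + + 2 - (N - 1ℤ)) * h - N * i - + 2 * g)
      + ((+ 3 * (N * N * N * N) - N * N * N + + 9 * (N * N) - + 7 * N + + 4) * g
         - (+ 6 * (N * N) - + 4 * N + + 6) * e)
    lem = solve-∀

  row-0 : ∀ N n → row N n (+ 0) ≡ + (N ℕ.^ n)
  row-0 N zero = refl
  row-0 N (suc n) = trans (ℤₚ.+-identityʳ (+ N * row N n (+ 0)))
    (trans (cong (+ N *_) (row-0 N n)) (sym (ℤₚ.pos-* N (N ℕ.^ n))))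

  -- At index N - 1, e^{Nx} (1 - x) gives N^{N-1} - (N - 1) N^{N-2} = N^{N-2}, the number of parking
  -- functions of length N - 1.
  row-1-subtop : ∀ n → row (suc (suc n)) (suc n) (+ 1) ≡ + (suc (suc n) ℕ.^ n)
  row-1-subtop n = trans (lem (+ suc n) (row (suc (suc n)) n (+ 0)) (row (suc (suc n)) n -[1+ 0 ]) _
    (coeff-suc (+ suc (suc n)) (+ 0) n))
    (row-0 (suc (suc n)) n)
    where
    lem₁ : ∀ n x q y → y ≡ x + (n * x - (((1ℤ + n) * x - 0ℤ * q) - y))
    lem₁ = solve-∀
    lem₂ : ∀ x z → x + (z - z) ≡ x
    lem₂ = solve-∀
    lem : ∀ n x q y → n * x ≡ ((1ℤ + n) * x - 0ℤ * q) - y → y ≡ x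
    lem n x q y eq = trans (lem₁ n x q y) (trans (cong (λ z → x + (n * x - z)) (sym eq)) (lem₂ x (n * x)))

  -- n! Σ_{i ≤ n} Nⁱ/i!.
  expPartial : ℕ → ℕ → ℕ
  expPartial N zero = 1
  expPartial N (suc n) = suc n ℕ.* expPartial N n ℕ.+ N ℕ.^ suc n

  -- Division by 1 - x turns the coefficients of e^{Nx} into their partial sums.
  row-−1 : ∀ N n → row N n (- + 1) ≡ + expPartial N n
  row-−1 N zero = refl
  row-−1 N (suc n) = begin
    row N (suc n) (- + 1) ≡⟨ lem _ _ ⟩
    (row N (suc n) (- + 1) - row N (suc n) (+ 0)) + row N (suc n) (+ 0)
      ≡⟨ cong₂ _+_ (sym (coeff-suc (+ N) (- + 1) n)) (row-0 N (suc n)) ⟩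
    + suc n * row N n (- + 1) + + (N ℕ.^ suc n) ≡⟨ cong (λ x → + suc n * x + + (N ℕ.^ suc n)) (row-−1 N n) ⟩
    + suc n * + expPartial N n + + (N ℕ.^ suc n)
      ≡⟨ cong (λ x → x + + (N ℕ.^ suc n)) (ℤₚ.pos-* (suc n) (expPartial N n)) ⟨
    + expPartial N (suc n) ∎
    where
    lem : ∀ x y → x ≡ (x - y) + y
    lem = solve-∀

  -- The total of Area (Area - 1) in closed form.

  module Total (k : ℕ) where
    n N L q : ℕ
    n = suc k
    N = suc n
    L = N ℕ.^ k
    q = expPartial N n

    parkedCount : parkedSum one n n ≡ + L
    parkedCount = trans (sym (ℤₚ.*-identityˡ _)) (trans (moment₀ n n (ℕₚ.n≤1+n n))
      (trans (ℤₚ.+-identityʳ _) (trans (ℤₚ.*-identityˡ _) (row-1-subtop k))))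

    parkedFirst : + 2 * parkedSum (λ t → t) n n ≡ (+ N * + N - + N + 1ℤ) * + L - + q
    parkedFirst = trans (moment₁ n n (ℕₚ.n≤1+n n)) (trans (closed₁-subtop (+ N) (row N n) (row-relations N n))
      (cong₂ (λ x y → (+ N * + N - + N + 1ℤ) * x - y) (row-1-subtop k) (row-−1 N n)))

    parkedSecond : + 12 * parkedSum (λ t → t * t) n n ≡
      (+ 3 * (+ N * + N * + N * + N) - + N * + N * + N + + 9 * (+ N * + N) - + 7 * + N + + 4) * + L
      - (+ 6 * (+ N * + N) - + 4 * + N + + 6) * + q
    parkedSecond = trans (moment₂ n n (ℕₚ.n≤1+n n)) (trans (closed₂-subtop (+ N) (row N n) (row-relations N n))
      (cong₂ (λ x y → (+ 3 * (+ N * + N * + N * + N) - + N * + N * + N + + 9 * (+ N * + N) - + 7 * + N + + 4) * x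
        - (+ 6 * (+ N * + N) - + 4 * + N + + 6) * y) (row-1-subtop k) (row-−1 N n)))

    areaTotal-closed : + 12 * areaTotal n ≡
      (+ 27 * (+ n * + n) + + 38 * + n + + 14 + + 5 * (+ n * + n * + n)) * + L - + 14 * (+ N * + q)
    areaTotal-closed = begin
      + 12 * areaTotal n ≡⟨ cong (+ 12 *_) (areaTotal-parkedSum n) ⟩
      -- Regrouping lets the offset and the higher moments occur only as 2 c, 2 M₁ and 12 M₂, the
      -- multiples known in closed form.
      + 12 * (1ℤ * M₂ + 1ℤ * ((1ℤ - + 2 * c) * M₁ + (c * c - c) * M₀)) ≡⟨ lem₁ c M₀ M₁ M₂ ⟩
      + 12 * M₂ + + 6 * ((1ℤ - + 2 * c) * (+ 2 * M₁)) + + 3 * (((+ 2 * c) * (+ 2 * c - + 2)) * M₀)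
        ≡⟨ cong (λ e → + 12 * M₂ + + 6 * ((1ℤ - e) * (+ 2 * M₁)) + + 3 * ((e * (e - + 2)) * M₀)) (2*offset n) ⟩
      + 12 * M₂ + + 6 * ((1ℤ - e) * (+ 2 * M₁)) + + 3 * ((e * (e - + 2)) * M₀)
        ≡⟨ lem₃ parkedSecond parkedFirst parkedCount ⟩
      -- The quartic terms at L and the quadratic terms at q cancel, leaving a cubic and -14 N.
      _ ≡⟨ lem₂ (+ n) (+ L) (+ q) ⟩
      (+ 27 * (+ n * + n) + + 38 * + n + + 14 + + 5 * (+ n * + n * + n)) * + L - + 14 * (+ N * + q) ∎
      where
      c = offset n
      e = + n * (+ n - 1ℤ)
      M₀ = parkedSum one n n
      M₁ = parkedSum (λ t → t) n n
      M₂ = parkedSum (λ t → t * t) n n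
      lem₁ : ∀ c x y z → + 12 * (1ℤ * z + 1ℤ * ((1ℤ - + 2 * c) * y + (c * c - c) * x)) ≡
        + 12 * z + + 6 * ((1ℤ - + 2 * c) * (+ 2 * y)) + + 3 * (((+ 2 * c) * (+ 2 * c - + 2)) * x)
      lem₁ = solve-∀
      lem₃ : ∀ {x y z x′ y′ z′} → x ≡ x′ → y ≡ y′ → z ≡ z′ →
        x + + 6 * ((1ℤ - e) * y) + + 3 * ((e * (e - + 2)) * z) ≡ x′ + + 6 * ((1ℤ - e) * y′) + + 3 *
          ((e * (e - + 2)) * z′)
      lem₃ refl refl refl = refl
      lem₂ : ∀ n L q →
        (+ 3 * ((1ℤ + n) * (1ℤ + n) * (1ℤ + n) * (1ℤ + n)) - (1ℤ + n) * (1ℤ + n) * (1ℤ + n) + + 9 *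
          ((1ℤ + n) * (1ℤ + n)) - + 7 * (1ℤ + n) + + 4) * L
        - (+ 6 * ((1ℤ + n) * (1ℤ + n)) - + 4 * (1ℤ + n) + + 6) * q
        + + 6 * ((1ℤ - n * (n - 1ℤ)) * (((1ℤ + n) * (1ℤ + n) - (1ℤ + n) + 1ℤ) * L - q))
        + + 3 * ((n * (n - 1ℤ) * (n * (n - 1ℤ) - + 2)) * L) ≡
        (+ 27 * (n * n) + + 38 * n + + 14 + + 5 * (n * n * n)) * L - + 14 * ((1ℤ + n) * q)
      lem₂ = solve-∀

open IntegerMoments

-- Bounds on the partial exponential sum.

module ExpPartialBounds where
  open import Data.Nat
  open import Data.Nat.Tactic.RingSolver using (solve-∀)
  open import Data.Nat.Properties
  open ≤-Reasoning

  -- Successive terms of q, from N^n downwards, shrink by factors at most n/N, so q is at most the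
  -- geometric sum N^n/(1 - n/N), where N - n = d + 1. The induction keeps N fixed, so d grows as n
  -- falls.
  expPartial-linear : ∀ n d → let N = suc n + d in suc d * expPartial N n ≤ N * N ^ n
  expPartial-linear zero d = ≤-refl
  expPartial-linear (suc n) d = begin
    suc d * (suc n * expPartial N n + N * P) ≡⟨ lem₁ n d (expPartial N n) (N * P) ⟩
    suc n * (suc d * expPartial N n) + suc d * (N * P)
      ≤⟨ +-monoˡ-≤ _ (*-monoʳ-≤ (suc n) (*-monoˡ-≤ (expPartial N n) (n≤1+n (suc d)))) ⟩
    suc n * (suc (suc d) * expPartial N n) + suc d * (N * P) ≤⟨ +-monoˡ-≤ _ (*-monoʳ-≤ (suc n) IH) ⟩
    suc n * (N * P) + suc d * (N * P) ≡⟨ lem₂ n d (N * P) ⟩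
    N * (N * P) ∎
    where
    N = suc (suc n) + d
    P = N ^ n
    IH : suc (suc d) * expPartial N n ≤ N * P
    IH = subst (λ N → suc (suc d) * expPartial N n ≤ N * N ^ n) (cong suc (+-suc n d)) (expPartial-linear n (suc d))
    lem₁ : ∀ n d q x → (1 + d) * ((1 + n) * q + x) ≡ (1 + n) * ((1 + d) * q) + (1 + d) * x
    lem₁ = solve-∀
    lem₂ : ∀ n d x → (1 + n) * x + (1 + d) * x ≡ (2 + n + d) * x
    lem₂ = solve-∀

  -- Writing q = Σ_j b_j with b_j = n(n−1)⋯(n−j+1) N^{n−j}, this says q² ≤ 2 N^n Σ_j (j + 1) b_j, which holds as
  -- 0 ≤ b_j ≤ N^n; the weighted sum telescopes because N b_{j+1} = (n − j) b_j.
  expPartial-quadratic : ∀ n d → let N = suc n + d; P = N ^ n; q = expPartial N n in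
    q * q + 2 * d * P * q ≤ 2 * N * (P * P)
  expPartial-quadratic zero d = begin
    1 + 2 * d * 1 * 1 ≤⟨ n≤1+n _ ⟩
    2 + 2 * d * 1 * 1 ≡⟨ lem d ⟩
    2 * suc d * (1 * 1) ∎
    where
    lem : ∀ d → 2 + 2 * d * 1 * 1 ≡ 2 * (1 + d) * (1 * 1)
    lem = solve-∀
  expPartial-quadratic (suc n) d = +-cancelʳ-≤ (suc n * suc n * (2 * suc d * P * q)) _ _ (begin
    (suc n * q + N * P) * (suc n * q + N * P) + 2 * d * (N * P) * (suc n * q + N * P) + suc n * suc n *
      (2 * suc d * P * q)
      -- The mixed term 2 (n + 1) (d + 1) N P q is split by N = (n + 1) + (d + 1): one part joins q²
      -- for the induction hypothesis, the other is left to `IH-linear`.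
      ≡⟨ lem₁ n d P q ⟩
    suc n * suc n * (q * q + 2 * suc d * P * q) + suc n * suc n * (2 * suc d * P * q)
      + 2 * suc n * suc d * P * (suc d * q) + suc (2 * d) * (N * P) * (N * P)
      ≤⟨ +-monoˡ-≤ (suc (2 * d) * (N * P) * (N * P))
        (+-mono-≤ (+-monoˡ-≤ (suc n * suc n * (2 * suc d * P * q)) (*-monoʳ-≤ (suc n * suc n) IH))
           (*-monoʳ-≤ (2 * suc n * suc d * P) (≤-trans (*-monoˡ-≤ q (n≤1+n (suc d))) IH-linear))) ⟩
    suc n * suc n * (2 * N * (P * P)) + suc n * suc n * (2 * suc d * P * q)
      + 2 * suc n * suc d * P * (N * P) + suc (2 * d) * (N * P) * (N * P)
      -- One further (N P)² completes the bound to exactly 2 N (N P)².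
      ≤⟨ m≤m+n _ (N * P * (N * P)) ⟩
    suc n * suc n * (2 * N * (P * P)) + suc n * suc n * (2 * suc d * P * q)
      + 2 * suc n * suc d * P * (N * P) + suc (2 * d) * (N * P) * (N * P) + N * P * (N * P)
      ≡⟨ lem₂ n d P q ⟩
    2 * N * (N * P * (N * P)) + suc n * suc n * (2 * suc d * P * q) ∎)
    where
    N = suc (suc n) + d
    P = N ^ n
    q = expPartial N n
    IH-linear : suc (suc d) * expPartial N n ≤ N * P
    IH-linear = subst (λ N → suc (suc d) * expPartial N n ≤ N * N ^ n) (cong suc (+-suc n d))
      (expPartial-linear n (suc d))
    IH : q * q + 2 * suc d * P * q ≤ 2 * N * (P * P)
    IH = subst (λ N → expPartial N n * expPartial N n + 2 * suc d * N ^ n * expPartial N n ≤ 2 * N *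
      (N ^ n * N ^ n)) (cong suc (+-suc n d)) (expPartial-quadratic n (suc d))
    lem₁ : ∀ n d P q →
      ((1 + n) * q + (2 + n + d) * P) * ((1 + n) * q + (2 + n + d) * P) + 2 * d * ((2 + n + d) * P) *
        ((1 + n) * q + (2 + n + d) * P)
      + (1 + n) * (1 + n) * (2 * (1 + d) * P * q) ≡
      (1 + n) * (1 + n) * (q * q + 2 * (1 + d) * P * q) + (1 + n) * (1 + n) * (2 * (1 + d) * P * q)
      + 2 * (1 + n) * (1 + d) * P * ((1 + d) * q) + (1 + 2 * d) * ((2 + n + d) * P) * ((2 + n + d) * P)
    lem₁ = solve-∀
    lem₂ : ∀ n d P q →
      (1 + n) * (1 + n) * (2 * (2 + n + d) * (P * P)) + (1 + n) * (1 + n) * (2 * (1 + d) * P * q)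
      + 2 * (1 + n) * (1 + d) * P * ((2 + n + d) * P) + (1 + 2 * d) * ((2 + n + d) * P) * ((2 + n + d) * P)
      + (2 + n + d) * P * ((2 + n + d) * P) ≡
      2 * (2 + n + d) * ((2 + n + d) * P * ((2 + n + d) * P)) + (1 + n) * (1 + n) * (2 * (1 + d) * P * q)
    lem₂ = solve-∀

  -- The case d = 0, where the term linear in q vanishes. It makes q of order N^{n + 1/2}, the
  -- source of the exponent 5/2.
  expPartial-sqrt : ∀ n → let N = suc n; P = N ^ n; q = expPartial N n in q * q ≤ 2 * N * (P * P)
  expPartial-sqrt n = subst (λ N → expPartial N n * expPartial N n ≤ 2 * N * (N ^ n * N ^ n)) (+-identityʳ (suc n))
    (≤-trans (m≤m+n _ (2 * 0 * (suc n + 0) ^ n * expPartial (suc n + 0) n)) (expPartial-quadratic n 0))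

  -- Bound on the deviation from the leading term.

  module _ (k : ℕ) where
    open Total k using (n; N; L; q)

    private
      -- By `areaTotal-closed`, 12 `areaTotal n` is 5 n³ L + D - A. The squares of A and D are
      -- measured in units of X, with the factor 144 = 12² kept apart for the later division.
      A D X : ℕ
      A = 14 * (N * q)
      D = (27 * (n * n) + 38 * n + 14) * L
      X = n * (n * (n * (n * n))) * (L * L)

    A-bound : A * A ≤ 144 * 98 * X
    A-bound = begin
      A * A ≡⟨ lem₁ 14 N q ⟩
      196 * (N * N) * (q * q) ≤⟨ *-monoʳ-≤ (196 * (N * N)) (expPartial-sqrt n) ⟩
      196 * (N * N) * (2 * N * (N * L * (N * L))) ≡⟨ lem₂ 196 N L ⟩
      196 * 2 * (N * (N * (N * (N * N))) * (L * L))
        ≤⟨ *-monoʳ-≤ (196 * 2) (*-monoˡ-≤ (L * L) (*-mono-≤ N≤2n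
          (*-mono-≤ N≤2n (*-mono-≤ N≤2n (*-mono-≤ N≤2n N≤2n))))) ⟩
      196 * 2 * (2 * n * (2 * n * (2 * n * (2 * n * (2 * n)))) * (L * L)) ≡⟨ lem₃ 196 n L ⟩
      -- The factor 64 is 2 · 2⁵, and 196 · 64 = 12544 is rounded up to 14112 = 144 · 98.
      196 * 64 * X ≤⟨ *-monoˡ-≤ X (≤ᵇ⇒≤ (196 * 64) (144 * 98) _) ⟩
      144 * 98 * X ∎
      where
      N≤2n : N ≤ 2 * n
      N≤2n = ≤-trans (≤-reflexive (+-comm 1 n)) (+-monoʳ-≤ n (s≤s z≤n))
      lem₁ : ∀ c N q → c * (N * q) * (c * (N * q)) ≡ c * c * (N * N) * (q * q)
      lem₁ = solve-∀
      lem₂ : ∀ c N L → c * (N * N) * (2 * N * (N * L * (N * L))) ≡ c * 2 * (N * (N * (N * (N * N))) * (L * L))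
      lem₂ = solve-∀
      lem₃ : ∀ c n L → c * 2 * (2 * n * (2 * n * (2 * n * (2 * n * (2 * n)))) * (L * L)) ≡
        c * 64 * (n * (n * (n * (n * n))) * (L * L))
      lem₃ = solve-∀

    D-bound : D * D ≤ 144 * 49 * X
    D-bound = begin
      D * D ≤⟨ *-mono-≤ D≤ D≤ ⟩
      84 * (n * n) * L * (84 * (n * n) * L) ≡⟨ lem₁ 84 n L ⟩
      84 * 84 * (n * (n * (n * n)) * (L * L))
        ≤⟨ *-monoʳ-≤ (84 * 84) (*-monoˡ-≤ (L * L) (m≤n*m (n * (n * (n * n))) n)) ⟩
      144 * 49 * X ∎
      where
      lem₁ : ∀ c n L → c * (n * n) * L * (c * (n * n) * L) ≡ c * c * (n * (n * (n * n)) * (L * L))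
      lem₁ = solve-∀
      lem₂ : ∀ n → 27 * (n * n) + 38 * (n * n) + 19 * (n * n) ≡ 84 * (n * n)
      lem₂ = solve-∀
      D≤ : D ≤ 84 * (n * n) * L
      D≤ = *-monoˡ-≤ L (begin
        27 * (n * n) + 38 * n + 14 ≤⟨ +-mono-≤ (+-monoʳ-≤ (27 * (n * n)) (*-monoʳ-≤ 38 (m≤n*m n n)))
          -- Rounding 14 up to 19 gives the total 84 = 12 · 7, whose square is 144 · 49.
          (≤-trans (≤ᵇ⇒≤ 14 (19 * 1) _) (*-monoʳ-≤ 19 (s≤s z≤n))) ⟩
        27 * (n * n) + 38 * (n * n) + 19 * (n * n) ≡⟨ lem₂ n ⟩
        84 * (n * n) ∎)

    -- 98 + 49 = 147 is rounded up to the square 196 = 14².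
    squares-bound : A * A + D * D ≤ 144 * (L * L) * (196 * (n * (n * (n * (n * n)))))
    squares-bound = begin
      A * A + D * D ≤⟨ +-mono-≤ A-bound D-bound ⟩
      144 * 98 * X + 144 * 49 * X ≡⟨ *-distribʳ-+ X (144 * 98) (144 * 49) ⟨
      (144 * 98 + 144 * 49) * X ≤⟨ *-monoˡ-≤ X (≤ᵇ⇒≤ (144 * 98 + 144 * 49) (144 * 196) _) ⟩
      144 * 196 * X ≡⟨ lem 144 196 (n * (n * (n * (n * n)))) (L * L) ⟩
      144 * (L * L) * (196 * (n * (n * (n * (n * n))))) ∎
      where
      lem : ∀ a b x y → a * b * (x * y) ≡ a * y * (b * x)
      lem = solve-∀

open ExpPartialBounds using (squares-bound)

-- Integers inside the rationals.

open import Data.Rational as ℚ using (ℚ; _/_; _+_; _-_; _*_; -_; _≤_; 0ℚ; 1ℚ; toℚᵘ)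
open import Data.Rational.Unnormalised as ℚᵘ using (mkℚᵘ; *≡*)
import Data.Rational.Properties as ℚₚ
import Data.Rational.Unnormalised.Properties as ℚᵘₚ
open import Tactic.RingSolver using (solve-∀)
open import Tactic.RingSolver.Core.AlmostCommutativeRing using (AlmostCommutativeRing; fromCommutativeRing)

ℚ-ring : AlmostCommutativeRing 0ℓ 0ℓ
ℚ-ring = fromCommutativeRing ℚₚ.+-*-commutativeRing isZero?
  where
  isZero? : ∀ p → _
  isZero? p with 0ℚ ℚₚ.≟ p
  ... | yes eq = just eq
  ... | no _ = nothing

ι : ℤ → ℚ
ι z = z / 1

-- Normalised fractions do not compute on open terms, so arithmetic identities are checked on
-- unnormalised representatives.
ι-ℚᵘ : ∀ z → toℚᵘ (ι z) ℚᵘ.≃ mkℚᵘ z 0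
ι-ℚᵘ z = ℚₚ.toℚᵘ-fromℚᵘ (mkℚᵘ z 0)

ι-+ : ∀ a b → ι (a ℤ.+ b) ≡ ι a + ι b
ι-+ a b = ℚₚ.toℚᵘ-injective (begin
  toℚᵘ (ι (a ℤ.+ b)) ≈⟨ ι-ℚᵘ (a ℤ.+ b) ⟩
  mkℚᵘ (a ℤ.+ b) 0 ≈⟨ *≡* (cong (ℤ._* 1ℤ) (sym (cong₂ ℤ._+_ (ℤₚ.*-identityʳ a) (ℤₚ.*-identityʳ b)))) ⟩
  mkℚᵘ a 0 ℚᵘ.+ mkℚᵘ b 0 ≈⟨ ℚᵘₚ.+-cong (ι-ℚᵘ a) (ι-ℚᵘ b) ⟨
  toℚᵘ (ι a) ℚᵘ.+ toℚᵘ (ι b) ≈⟨ ℚₚ.toℚᵘ-homo-+ (ι a) (ι b) ⟨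
  toℚᵘ (ι a + ι b) ∎)
  where open import Relation.Binary.Reasoning.Setoid ℚᵘₚ.≃-setoid

ι-* : ∀ a b → ι (a ℤ.* b) ≡ ι a * ι b
ι-* a b = ℚₚ.toℚᵘ-injective (begin
  toℚᵘ (ι (a ℤ.* b)) ≈⟨ ι-ℚᵘ (a ℤ.* b) ⟩
  mkℚᵘ a 0 ℚᵘ.* mkℚᵘ b 0 ≈⟨ ℚᵘₚ.*-cong (ι-ℚᵘ a) (ι-ℚᵘ b) ⟨
  toℚᵘ (ι a) ℚᵘ.* toℚᵘ (ι b) ≈⟨ ℚₚ.toℚᵘ-homo-* (ι a) (ι b) ⟨
  toℚᵘ (ι a * ι b) ∎)
  where open import Relation.Binary.Reasoning.Setoid ℚᵘₚ.≃-setoid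

/-*-ι : ∀ z d .{{_ : ℕ.NonZero d}} → z / d * ι (+ d) ≡ ι z
/-*-ι z d@(suc d-1) = ℚₚ.toℚᵘ-injective (begin
  toℚᵘ (z / d * ι (+ d)) ≈⟨ ℚₚ.toℚᵘ-homo-* (z / d) (ι (+ d)) ⟩
  toℚᵘ (z / d) ℚᵘ.* toℚᵘ (ι (+ d)) ≈⟨ ℚᵘₚ.*-cong (ℚₚ.toℚᵘ-fromℚᵘ (mkℚᵘ z d-1)) (ι-ℚᵘ (+ d)) ⟩
  mkℚᵘ z d-1 ℚᵘ.* mkℚᵘ (+ d) 0
    ≈⟨ *≡* (trans (ℤₚ.*-identityʳ (z ℤ.* + d)) (cong (λ e → z ℤ.* + e) (sym (ℕₚ.*-identityʳ d)))) ⟩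
  mkℚᵘ z 0 ≈⟨ ι-ℚᵘ z ⟨
  toℚᵘ (ι z) ∎)
  where open import Relation.Binary.Reasoning.Setoid ℚᵘₚ.≃-setoid

ι-sub : ∀ a b → ι (a ℤ.- b) ≡ ι a - ι b
ι-sub a b = trans (ι-+ a (ℤ.- b)) (cong (λ x → ι a + x) (ι-neg b))
  where
  ι-neg : ∀ b → ι (ℤ.- b) ≡ - ι b
  ι-neg (+ zero) = refl
  ι-neg (+ suc b) = refl
  ι-neg ℤ.-[1+ b ] = lem (ι (+ suc b))
    where
    lem : ∀ p → p ≡ - (- p)
    lem = solve-∀ ℚ-ring

-- Pushes ι through integer expressions, which unification alone cannot invert.
record Image : Set where
  constructor image
  field
    int : ℤ
    rat : ℚ
    int↦rat : ι int ≡ rat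

open Image

infixl 7 _⊛_
infixl 6 _⊖_

_⊛_ _⊖_ : Image → Image → Image
image a x p ⊛ image b y q = image (a ℤ.* b) (x * y) (trans (ι-* a b) (cong₂ _*_ p q))
image a x p ⊖ image b y q = image (a ℤ.- b) (x - y) (trans (ι-sub a b) (cong₂ _-_ p q))

⌜_⌝ : ℤ → Image
⌜ z ⌝ = image z (ι z) refl

ι-mono-≤ : ∀ {a b} → a ℤ.≤ b → ι a ≤ ι b
ι-mono-≤ {a} {b} a≤b = ℚₚ.toℚᵘ-cancel-≤ (begin
  toℚᵘ (ι a) ≃⟨ ι-ℚᵘ a ⟩
  mkℚᵘ a 0 ≤⟨ ℚᵘ.*≤* (ℤₚ.*-monoʳ-≤-nonNeg 1ℤ a≤b) ⟩
  mkℚᵘ b 0 ≃⟨ ι-ℚᵘ b ⟨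
  toℚᵘ (ι b) ∎)
  where open ℚᵘₚ.≤-Reasoning

ι-pos : ∀ n .{{_ : ℕ.NonZero n}} → ℚ.Positive (ι (+ n))
ι-pos n = ℚₚ.normalize-pos n 1

*-cancelʳ-≡-pos : ∀ {p q} r .{{_ : ℚ.Positive r}} → p * r ≡ q * r → p ≡ q
*-cancelʳ-≡-pos r eq = ℚₚ.≤-antisym (ℚₚ.*-cancelʳ-≤-pos r (ℚₚ.≤-reflexive eq))
                                    (ℚₚ.*-cancelʳ-≤-pos r (ℚₚ.≤-reflexive (sym eq)))

-- The mean and the sum in E₁, cleared of denominators.

mean-* : ∀ xs → mean xs * ι (+ length xs) ≡ ι (foldr ℤ._+_ 0ℤ xs)
mean-* [] = refl
mean-* (x ∷ xs) = /-*-ι (foldr ℤ._+_ 0ℤ (x ∷ xs)) (suc (length xs))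

length-Σ : {A : Set} (xs : List A) → + length xs ≡ Σ (λ _ → 1ℤ) xs
length-Σ [] = refl
length-Σ (x ∷ xs) = cong (λ l → 1ℤ ℤ.+ l) (length-Σ xs)

expTerm : ℕ → ℕ → ℚ
expTerm N k = ((+ (N ℕ.^ k)) / (k !)) {{ ℕₚ._!≢0 k }}

-- `sumTo n` stops at k = n - 1, while `expPartial N n` includes k = n, whose term multiplied by n!
-- is N^n.
expSum : ∀ N n → ι (+ (n !)) * sumTo n (expTerm N) ≡ ι (+ expPartial N n ℤ.- + (N ℕ.^ n))
expSum N zero = refl
expSum N (suc n) = begin
  ι (+ (suc n !)) * (s + t)
    ≡⟨ cong (λ x → x * (s + t)) (trans (cong ι (ℤₚ.pos-* (suc n) (n !))) (ι-* (+ suc n) (+ (n !)))) ⟩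
  ι (+ suc n) * f * (s + t) ≡⟨ lem (ι (+ suc n)) f s t ⟩
  ι (+ suc n) * (f * s + t * f)
    ≡⟨ cong₂ (λ x y → ι (+ suc n) * (x + y)) (expSum N n) (/-*-ι (+ (N ℕ.^ n)) (n !) {{ ℕₚ._!≢0 n }}) ⟩
  ι (+ suc n) * (ι (+ expPartial N n ℤ.- + (N ℕ.^ n)) + ι (+ (N ℕ.^ n)))
    ≡⟨ cong (λ x → ι (+ suc n) * x) (ι-+ (+ expPartial N n ℤ.- + (N ℕ.^ n)) (+ (N ℕ.^ n))) ⟨
  ι (+ suc n) * ι (+ expPartial N n ℤ.- + (N ℕ.^ n) ℤ.+ + (N ℕ.^ n))
    ≡⟨ ι-* (+ suc n) (+ expPartial N n ℤ.- + (N ℕ.^ n) ℤ.+ + (N ℕ.^ n)) ⟨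
  ι (+ suc n ℤ.* (+ expPartial N n ℤ.- + (N ℕ.^ n) ℤ.+ + (N ℕ.^ n)))
    ≡⟨ cong ι (trans (lem₁ (+ suc n) (+ expPartial N n) (+ (N ℕ.^ n)) (+ (N ℕ.^ suc n)))
         (cong (λ x → x ℤ.+ + (N ℕ.^ suc n) ℤ.- + (N ℕ.^ suc n)) (sym (ℤₚ.pos-* (suc n) (expPartial N n))))) ⟩
  ι (+ expPartial N (suc n) ℤ.- + (N ℕ.^ suc n)) ∎
  where
  open ≡-Reasoning
  f = ι (+ (n !))
  s = sumTo n (expTerm N)
  t = expTerm N n
  lem : ∀ m f s t → m * f * (s + t) ≡ m * (f * s + t * f)
  lem = solve-∀ ℚ-ring
  lem₁ : ∀ m q p r → m ℤ.* (q ℤ.- p ℤ.+ p) ≡ m ℤ.* q ℤ.+ r ℤ.- r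
  lem₁ = ℤ-Ring.solve-∀

-- The second factorial moment and its asymptotics over the rationals.

module Moment (k : ℕ) where
  open Total k
  open ≡-Reasoning

  private
    instance
      L-nonZero : ℕ.NonZero L
      L-nonZero = ℕₚ.m^n≢0 N k

    l ν e : ℚ
    l = ι (+ L)
    ν = ι (+ n)
    e = E₁ n

    E₁Numerator : ℤ
    E₁Numerator = + q ℤ.- + N ℤ.* + L ℤ.- + n ℤ.* + L

  secondFactorialMoment-* : secondFactorialMoment n * l ≡ ι (areaTotal n)
  secondFactorialMoment-* = begin
    mean xs * l ≡⟨ cong (λ x → mean xs * ι x) count ⟨
    mean xs * ι (+ length xs) ≡⟨ mean-* xs ⟩
    ι (areaTotal n) ∎
    where
    xs = map (λ p → area n p ℤ.* (area n p ℤ.- ℤ.1ℤ)) (parkingFunctions n)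
    count : + length xs ≡ + L
    count = trans (cong +_ (Listₚ.length-map _ (parkingFunctions n)))
      (trans (length-Σ (parkingFunctions n)) (trans (parkingCount n) parkedCount))

  -- Since N!/N^n · N^{n-1} = n!, the sum in E₁ becomes q - N^n = q - N L by `expSum`; the term -n L
  -- comes from -n/2.
  E₁-* : ι (+ 2) * e * l ≡ ι E₁Numerator
  E₁-* = begin
    ι (+ 2) * e * l ≡⟨ lem₁ ((+ n) / 2) r s l ⟩
    r * s * l - (+ n) / 2 * ι (+ 2) * l ≡⟨ cong₂ (λ x y → x - y * l) main (/-*-ι (+ n) 2) ⟩
    ι (+ q ℤ.- + (N ℕ.^ n)) - ν * l ≡⟨ cong (λ x → ι (+ q ℤ.- x) - ν * l) (ℤₚ.pos-* N L) ⟩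
    ι (+ q ℤ.- + N ℤ.* + L) - ν * l ≡⟨ cong (λ x → ι (+ q ℤ.- + N ℤ.* + L) - x) (ι-* (+ n) (+ L)) ⟨
    ι (+ q ℤ.- + N ℤ.* + L) - ι (+ n ℤ.* + L) ≡⟨ ι-sub (+ q ℤ.- + N ℤ.* + L) (+ n ℤ.* + L) ⟨
    ι E₁Numerator ∎
    where
    r s f : ℚ
    r = ((+ (N !)) / (N ℕ.^ n)) {{ ℕₚ.m^n≢0 N n }}
    s = sumTo n (expTerm N)
    f = ι (+ (n !))
    lem₁ : ∀ a r s l → ι (+ 2) * (- a + (+ 1) / 2 * r * s) * l ≡ r * s * l - a * ι (+ 2) * l
    lem₁ = solve-∀ ℚ-ring
    lem₂ : ∀ r s l μ → r * s * l * μ ≡ r * (μ * l) * s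
    lem₂ = solve-∀ ℚ-ring
    lem₃ : ∀ μ f s → μ * f * s ≡ f * s * μ
    lem₃ = solve-∀ ℚ-ring
    main : r * s * l ≡ ι (+ q ℤ.- + (N ℕ.^ n))
    -- A further factor N turns L into N^n, the denominator of r.
    main = *-cancelʳ-≡-pos (ι (+ N)) {{ι-pos N}} (begin
      r * s * l * ι (+ N) ≡⟨ lem₂ r s l (ι (+ N)) ⟩
      r * (ι (+ N) * l) * s ≡⟨ cong (λ x → r * x * s) (trans (cong ι (ℤₚ.pos-* N L)) (ι-* (+ N) (+ L))) ⟨
      r * ι (+ (N ℕ.^ n)) * s ≡⟨ cong (λ x → x * s) (/-*-ι (+ (N !)) (N ℕ.^ n) {{ ℕₚ.m^n≢0 N n }}) ⟩
      ι (+ (N !)) * s ≡⟨ cong (λ x → x * s) (trans (cong ι (ℤₚ.pos-* N (n !))) (ι-* (+ N) (+ (n !)))) ⟩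
      ι (+ N) * f * s ≡⟨ lem₃ (ι (+ N)) f s ⟩
      f * s * ι (+ N) ≡⟨ cong (λ x → x * ι (+ N)) (expSum N n) ⟩
      ι (+ q ℤ.- + (N ℕ.^ n)) * ι (+ N) ∎)

  areaTotal-E₁ : ι (+ 12) * ι (areaTotal n) ≡
    (ι (+ 5) * (ν * ν * ν) - ν * ν - ι (+ 4) * ν) * l - ι (+ 14) * (ι (+ N) * (ι (+ 2) * e * l))
  areaTotal-E₁ = begin
    ι (+ 12) * ι (areaTotal n) ≡⟨ ι-* (+ 12) (areaTotal n) ⟨
    -- Writing q as `E₁Numerator` + (N + n) L turns 27 n² + 38 n + 14 into -n² - 4 n.
    ι (+ 12 ℤ.* areaTotal n) ≡⟨ cong ι (trans areaTotal-closed (lem (+ n) (+ L) (+ q))) ⟩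
    ι ((+ 5 ℤ.* (+ n ℤ.* + n ℤ.* + n) ℤ.- + n ℤ.* + n ℤ.- + 4 ℤ.* + n) ℤ.* + L ℤ.- + 14 ℤ.* (+ N ℤ.* E₁Numerator))
      ≡⟨ int↦rat ((⌜ + 5 ⌝ ⊛ (⌜ + n ⌝ ⊛ ⌜ + n ⌝ ⊛ ⌜ + n ⌝) ⊖ ⌜ + n ⌝ ⊛ ⌜ + n ⌝ ⊖ ⌜ + 4 ⌝ ⊛ ⌜ + n ⌝) ⊛ ⌜ + L ⌝
          ⊖ ⌜ + 14 ⌝ ⊛ (⌜ + N ⌝ ⊛ image E₁Numerator (ι (+ 2) * e * l) (sym E₁-*))) ⟩
    (ι (+ 5) * (ν * ν * ν) - ν * ν - ι (+ 4) * ν) * l - ι (+ 14) * (ι (+ N) * (ι (+ 2) * e * l)) ∎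
    where
    lem : ∀ n L q →
      (+ 27 ℤ.* (n ℤ.* n) ℤ.+ + 38 ℤ.* n ℤ.+ + 14 ℤ.+ + 5 ℤ.* (n ℤ.* n ℤ.* n)) ℤ.* L ℤ.- + 14 ℤ.* ((1ℤ ℤ.+ n) ℤ.* q) ≡
      (+ 5 ℤ.* (n ℤ.* n ℤ.* n) ℤ.- n ℤ.* n ℤ.- + 4 ℤ.* n) ℤ.* L
        ℤ.- + 14 ℤ.* ((1ℤ ℤ.+ n) ℤ.* (q ℤ.- (1ℤ ℤ.+ n) ℤ.* L ℤ.- n ℤ.* L))
    lem = ℤ-Ring.solve-∀

  secondFactorialMoment-closed : secondFactorialMoment n ≡
    (- ((+ 7) / 3)) * ℕtoℚ N * e + ((+ 5) / 12) * powℚ (ℕtoℚ n) 3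
    - ((+ 1) / 12) * powℚ (ℕtoℚ n) 2 - ((+ 1) / 3) * ℕtoℚ n
  secondFactorialMoment-closed = *-cancelʳ-≡-pos l {{ι-pos L}} (*-cancelʳ-≡-pos (ι (+ 12)) (begin
    secondFactorialMoment n * l * ι (+ 12) ≡⟨ cong (λ x → x * ι (+ 12)) secondFactorialMoment-* ⟩
    ι (areaTotal n) * ι (+ 12) ≡⟨ ℚₚ.*-comm (ι (areaTotal n)) (ι (+ 12)) ⟩
    ι (+ 12) * ι (areaTotal n) ≡⟨ areaTotal-E₁ ⟩
    (ι (+ 5) * (ν * ν * ν) - ν * ν - ι (+ 4) * ν) * l - ι (+ 14) * (ι (+ N) * (ι (+ 2) * e * l))
      ≡⟨ lem ν (ι (+ N)) e l ⟩
    ((- ((+ 7) / 3)) * ι (+ N) * e + ((+ 5) / 12) * powℚ ν 3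
      - ((+ 1) / 12) * powℚ ν 2 - ((+ 1) / 3) * ν) * l * ι (+ 12) ∎))
    where
    lem : ∀ ν μ e l →
      (ι (+ 5) * (ν * ν * ν) - ν * ν - ι (+ 4) * ν) * l - ι (+ 14) * (μ * (ι (+ 2) * e * l)) ≡
      ((- ((+ 7) / 3)) * μ * e + ((+ 5) / 12) * (ν * (ν * (ν * 1ℚ)))
        - ((+ 1) / 12) * (ν * (ν * 1ℚ)) - ((+ 1) / 3) * ν) * l * ι (+ 12)
    lem = solve-∀ ℚ-ring

  private
    A D : ℕ
    A = 14 ℕ.* (N ℕ.* q)
    D = (27 ℕ.* (n ℕ.* n) ℕ.+ 38 ℕ.* n ℕ.+ 14) ℕ.* L

    A-ℤ : + A ≡ + 14 ℤ.* (+ N ℤ.* + q)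
    A-ℤ = trans (ℤₚ.pos-* 14 (N ℕ.* q)) (cong (λ x → + 14 ℤ.* x) (ℤₚ.pos-* N q))

    D-ℤ : + D ≡ (+ 27 ℤ.* (+ n ℤ.* + n) ℤ.+ + 38 ℤ.* + n ℤ.+ + 14) ℤ.* + L
    D-ℤ = trans (ℤₚ.pos-* (27 ℕ.* (n ℕ.* n) ℕ.+ 38 ℕ.* n ℕ.+ 14) L)
      (cong (λ x → x ℤ.* + L) (cong₂ (λ x y → x ℤ.+ y ℤ.+ + 14)
        (trans (ℤₚ.pos-* 27 (n ℕ.* n)) (cong (λ x → + 27 ℤ.* x) (ℤₚ.pos-* n n))) (ℤₚ.pos-* 38 n)))

    y : ℚ
    y = secondFactorialMoment n - ((+ 5) / 12) * powℚ ν 3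

  scaled-deviation : y * ι (+ 12) * l ≡ ι (+ D ℤ.- + A)
  scaled-deviation = begin
    y * ι (+ 12) * l ≡⟨ lem₁ (secondFactorialMoment n) ν l ⟩
    ι (+ 12) * (secondFactorialMoment n * l) - ι (+ 5) * (ν * ν * ν) * l
      ≡⟨ int↦rat (⌜ + 12 ⌝ ⊛ image (areaTotal n) (secondFactorialMoment n * l) (sym secondFactorialMoment-*)
          ⊖ ⌜ + 5 ⌝ ⊛ (⌜ + n ⌝ ⊛ ⌜ + n ⌝ ⊛ ⌜ + n ⌝) ⊛ ⌜ + L ⌝) ⟨
    ι (+ 12 ℤ.* areaTotal n ℤ.- + 5 ℤ.* (+ n ℤ.* + n ℤ.* + n) ℤ.* + L)
      ≡⟨ cong (λ x → ι (x ℤ.- + 5 ℤ.* (+ n ℤ.* + n ℤ.* + n) ℤ.* + L)) areaTotal-closed ⟩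
    _
      ≡⟨ cong ι (lem₂ (+ 27 ℤ.* (+ n ℤ.* + n) ℤ.+ + 38 ℤ.* + n ℤ.+ + 14) (+ 5 ℤ.* (+ n ℤ.* + n ℤ.* + n)) (+ L)
        (+ 14 ℤ.* (+ N ℤ.* + q))) ⟩
    ι ((+ 27 ℤ.* (+ n ℤ.* + n) ℤ.+ + 38 ℤ.* + n ℤ.+ + 14) ℤ.* + L ℤ.- + 14 ℤ.* (+ N ℤ.* + q))
      ≡⟨ cong₂ (λ a b → ι (a ℤ.- b)) D-ℤ A-ℤ ⟨
    ι (+ D ℤ.- + A) ∎
    where
    lem₁ : ∀ m ν l → (m - ((+ 5) / 12) * (ν * (ν * (ν * 1ℚ)))) * ι (+ 12) * l ≡ ι (+ 12) * (m * l) - ι (+ 5) *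
      (ν * ν * ν) * l
    lem₁ = solve-∀ ℚ-ring
    lem₂ : ∀ p c L a → (p ℤ.+ c) ℤ.* L ℤ.- a ℤ.- c ℤ.* L ≡ p ℤ.* L ℤ.- a
    lem₂ = ℤ-Ring.solve-∀

  -- Twelve times the deviation is (D − A)/L, and A, D ≥ 0 gives (D − A)² ≤ A² + D².
  deviation-bound : powℚ y 2 ≤ powℚ (ι (+ 14)) 2 * powℚ ν 5
  deviation-bound = ℚₚ.*-cancelʳ-≤-pos (ι (+ (144 ℕ.* (L ℕ.* L)))) {{positive}}
    (subst₂ _≤_ lhs rhs (ι-mono-≤ squares))
    where
    positive : ℚ.Positive (ι (+ (144 ℕ.* (L ℕ.* L))))
    positive = ι-pos (144 ℕ.* (L ℕ.* L)) {{ℕₚ.m*n≢0 144 (L ℕ.* L) {{_}} {{ℕₚ.m*n≢0 L L}}}}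
    144LL : + (144 ℕ.* (L ℕ.* L)) ≡ + 144 ℤ.* (+ L ℤ.* + L)
    144LL = trans (ℤₚ.pos-* 144 (L ℕ.* L)) (cong (λ x → + 144 ℤ.* x) (ℤₚ.pos-* L L))
    scale-ℚ : ι (+ 144) * (l * l) ≡ ι (+ (144 ℕ.* (L ℕ.* L)))
    scale-ℚ = trans (sym (int↦rat (⌜ + 144 ⌝ ⊛ (⌜ + L ⌝ ⊛ ⌜ + L ⌝)))) (cong ι (sym 144LL))
    n⁵ : ∀ n → + (n ℕ.* (n ℕ.* (n ℕ.* (n ℕ.* n)))) ≡ + n ℤ.* (+ n ℤ.* (+ n ℤ.* (+ n ℤ.* + n)))
    n⁵ n = step (step (step (ℤₚ.pos-* n n)))
      where
      step : ∀ {a b} → + a ≡ b → + (n ℕ.* a) ≡ + n ℤ.* b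
      step {a} eq = trans (ℤₚ.pos-* n a) (cong (λ x → + n ℤ.* x) eq)
    squares : (+ D ℤ.- + A) ℤ.* (+ D ℤ.- + A) ℤ.≤ +
      (144 ℕ.* (L ℕ.* L) ℕ.* (196 ℕ.* (n ℕ.* (n ℕ.* (n ℕ.* (n ℕ.* n))))))
    squares = ℤₚ.≤-trans (subst (ℤ._≤ + (A ℕ.* A ℕ.+ D ℕ.* D)) eq
      (ℤₚ.i-j≤i (+ (A ℕ.* A ℕ.+ D ℕ.* D)) (+ (2 ℕ.* (A ℕ.* D)))))
      (ℤ.+≤+ (squares-bound k))
      where
      lem : ∀ a d → a ℤ.* a ℤ.+ d ℤ.* d ℤ.- + 2 ℤ.* (a ℤ.* d) ≡ (d ℤ.- a) ℤ.* (d ℤ.- a)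
      lem = ℤ-Ring.solve-∀
      eq : + (A ℕ.* A ℕ.+ D ℕ.* D) ℤ.- + (2 ℕ.* (A ℕ.* D)) ≡ (+ D ℤ.- + A) ℤ.* (+ D ℤ.- + A)
      eq = trans (cong₂ ℤ._-_ (cong₂ ℤ._+_ (ℤₚ.pos-* A A) (ℤₚ.pos-* D D))
        (trans (ℤₚ.pos-* 2 (A ℕ.* D)) (cong (λ x → + 2 ℤ.* x) (ℤₚ.pos-* A D)))) (lem (+ A) (+ D))
    lhs : ι ((+ D ℤ.- + A) ℤ.* (+ D ℤ.- + A)) ≡ powℚ y 2 * ι (+ (144 ℕ.* (L ℕ.* L)))
    lhs = begin
      ι ((+ D ℤ.- + A) ℤ.* (+ D ℤ.- + A)) ≡⟨ ι-* (+ D ℤ.- + A) (+ D ℤ.- + A) ⟩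
      ι (+ D ℤ.- + A) * ι (+ D ℤ.- + A) ≡⟨ cong₂ _*_ scaled-deviation scaled-deviation ⟨
      y * ι (+ 12) * l * (y * ι (+ 12) * l) ≡⟨ lem y l ⟩
      powℚ y 2 * (ι (+ 144) * (l * l)) ≡⟨ cong (λ x → powℚ y 2 * x) scale-ℚ ⟩
      powℚ y 2 * ι (+ (144 ℕ.* (L ℕ.* L))) ∎
      where
      lem : ∀ y l → y * ι (+ 12) * l * (y * ι (+ 12) * l) ≡ y * (y * 1ℚ) * (ι (+ 144) * (l * l))
      lem = solve-∀ ℚ-ring
    rhs : ι (+ (144 ℕ.* (L ℕ.* L) ℕ.* (196 ℕ.* (n ℕ.* (n ℕ.* (n ℕ.* (n ℕ.* n))))))) ≡
      powℚ (ι (+ 14)) 2 * powℚ ν 5 * ι (+ (144 ℕ.* (L ℕ.* L)))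
    rhs = begin
      _ ≡⟨ cong ι (trans (ℤₚ.pos-* (144 ℕ.* (L ℕ.* L)) (196 ℕ.* X)) (cong₂ ℤ._*_ 144LL
             (trans (ℤₚ.pos-* 196 X) (cong (λ x → + 196 ℤ.* x) (n⁵ n))))) ⟩
      ι (+ 144 ℤ.* (+ L ℤ.* + L) ℤ.* (+ 196 ℤ.* (+ n ℤ.* (+ n ℤ.* (+ n ℤ.* (+ n ℤ.* + n))))))
        ≡⟨ int↦rat (⌜ + 144 ⌝ ⊛ (⌜ + L ⌝ ⊛ ⌜ + L ⌝) ⊛
          (⌜ + 196 ⌝ ⊛ (⌜ + n ⌝ ⊛ (⌜ + n ⌝ ⊛ (⌜ + n ⌝ ⊛ (⌜ + n ⌝ ⊛ ⌜ + n ⌝)))))) ⟩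
      ι (+ 144) * (l * l) * (ι (+ 196) * (ν * (ν * (ν * (ν * ν))))) ≡⟨ lem (ι (+ 144) * (l * l)) ν ⟩
      powℚ (ι (+ 14)) 2 * powℚ ν 5 * (ι (+ 144) * (l * l))
        ≡⟨ cong (λ x → powℚ (ι (+ 14)) 2 * powℚ ν 5 * x) scale-ℚ ⟩
      powℚ (ι (+ 14)) 2 * powℚ ν 5 * ι (+ (144 ℕ.* (L ℕ.* L))) ∎
      where
      X = n ℕ.* (n ℕ.* (n ℕ.* (n ℕ.* n)))
      lem : ∀ s ν → s * (ι (+ 196) * (ν * (ν * (ν * (ν * ν))))) ≡
        ι (+ 14) * (ι (+ 14) * 1ℚ) * (ν * (ν * (ν * (ν * (ν * 1ℚ))))) * s
      lem = solve-∀ ℚ-ring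

theorem2 : ((n : ℕ) → n ≥ 1 →
    secondFactorialMoment n
    ≡ (- ((+ 7) / 3)) * ℕtoℚ (suc n) * E₁ n
    + ((+ 5) / 12) * powℚ (ℕtoℚ n) 3
    - ((+ 1) / 12) * powℚ (ℕtoℚ n) 2
    - ((+ 1) / 3) * ℕtoℚ n)
    ×
    (∃[ C ] ∃[ N ] ((n : ℕ) → n ≥ N →
    powℚ (secondFactorialMoment n - ((+ 5) / 12) * powℚ (ℕtoℚ n) 3) 2
    ≤ powℚ C 2 * powℚ (ℕtoℚ n) 5))
theorem2 = (λ { (suc k) _ → Moment.secondFactorialMoment-closed k }) ,
  -- The constant 14 is the square root of the 196 in `squares-bound`; comparing squares expresses
  -- the order n^{5/2} within ℚ.
  (ι (+ 14) , 1 , λ { (suc k) _ → Moment.deviation-bound k })
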